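{- Let $\mathcal C$ be an $\mathbb F_{q^n}$-linear rank metric code of dimension $k>2$ contained in $\mathcal L_{n,q}$, with $\mathcal C\cap\mathcal U_1=\{0\}$. Suppose there exists an integer $s$ with $\gcd(s,n)=1$ such that: (1) $\dim(\mathcal C\cap\mathcal C^{[s]})=k-2$ and $\dim(\mathcal C\cap\mathcal C^{[s]}\cap\mathcal C^{[2s]})=k-3$; that is, there exist $p(x),q(x)\in\mathcal L_{n,q}$, with $q(x)\in\mathcal C$, such that \[\mathcal C=\langle p(x)^{[s]},p(x)^{[2s]},\ldots,p(x)^{[s(k-1)]}\rangle_{\mathbb F_{q^n}}\oplus\langle q(x)\rangle_{\mathbb F_{q^n}};\] (2) $p(x)$ is invertible and there exists $\eta\in\mathbb F_{q^n}^*$ such that $p(x)+\eta\,p(x)^{[sk]}\in\mathcal C$ and $\mathrm N_{q^n/q}(\eta)\neq(-1)^{kn}$. Then $\mathcal C$ is an MRD code equivalent to $\mathcal H_{k,s}(\eta)$.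
   Context: $q$ is a prime power, $[i]:=q^i$. $\mathcal L_{n,q}$ is the $\mathbb F_{q^n}$-vector space of linearized polynomials $f(x)=\sum_{i=0}^{n-1}a_ix^{[i]}$, $a_i\in\mathbb F_{q^n}$, identified with $\mathbb F_q$-linear maps of $\mathbb F_{q^n}$ (rank = $\mathbb F_q$-dimension of the image). $\mathcal U_1$ is the set of elements of rank at most one. For $f(x)=\sum_i a_ix^{[i]}$, $f(x)^{[j]}:=x^{[j]}\circ f(x)=\sum_i a_i^{[j]}x^{[(i+j)\bmod n]}$, and $\mathcal C^{[j]}=\{f^{[j]}\colon f\in\mathcal C\}$. A code (an $\mathbb F_q$-subspace of $\mathcal L_{n,q}$ with rank distance $\mathrm{rk}(f-g)$, minimum distance $d$) is MRD if $|\mathcal C|=q^{n(n-d+1)}$. $\mathrm N_{q^n/q}(\eta)=\prod_{i=0}^{n-1}\eta^{[i]}$. $\mathcal H_{k,s}(\eta)=\langle x+\eta x^{[sk]},x^{[s]},\ldots,x^{[s(k-1)]}\rangle_{\mathbb F_{q^n}}$. Codes $\mathcal C,\mathcal C'$ are equivalent if there are invertible $h,g\in\mathcal L_{n,q}$ and a field automorphism $\sigma$ (acting on coefficients) with $\{h\circ f^\sigma\circ g\colon f\in\mathcal C\}=\mathcal C'$. -}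

module Defs where

open import Level using (0ℓ)
open import Algebra.Bundles using (CommutativeRing; RawRing)
open import Algebra.Structures using (IsCommutativeRing)
open import Algebra.Definitions.RawMonoid using () renaming (sum to sumₘ)
open import Algebra.Definitions.RawSemiring as RawSemiringDefs using ()
open import Algebra.Module.Bundles.Raw using (RawLeftModule)
open import Algebra.Module.Construct.TensorUnit using () renaming (rawLeftModule to tensorUnit)
open import Algebra.Morphism.Structures using (module RingMorphisms)
open import Data.Fin.Base using (Fin; zero; suc; toℕ; fromℕ<)
open import Data.Integer.Base using (ℤ; +_; _%ℕ_) renaming (_+_ to _+ℤ_; _*_ to _*ℤ_)
open import Data.Integer.DivMod using (n%ℕd<d)
open import Data.Nat.Base using (ℕ; NonZero; _≤_; _∸_)
import Data.Nat.Base as ℕ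
open import Data.Nat.Primality using (Prime)
open import Data.Product.Base using (Σ-syntax; ∃-syntax; ∃₂; _×_)
open import Data.Vec.Base using (Vec; lookup; map; replicate; zipWith; _[_]≔_)
open import Data.Vec.Functional using (Vector)
open import Function.Bundles using (_↔_)
open import Function.Definitions using (Injective)
open import Relation.Binary.PropositionalEquality using (_≡_; _≢_)
open import Relation.Unary using (Pred; _∈_; _∩_; _≐_; ｛_｝; U)

IsPrimePower : ℕ → Set
IsPrimePower q = ∃₂ λ p e → Prime p × 1 ≤ e × q ≡ p ℕ.^ e

record FiniteField (order : ℕ) : Set₁ where
  infixl 6 _+_
  infixl 7 _*_
  infix  8 -_
  field
    Carrier           : Set
    _+_ _*_           : Carrier → Carrier → Carrier
    -_                : Carrier → Carrier
    0# 1#             : Carrier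
    isCommutativeRing : IsCommutativeRing _≡_ _+_ _*_ -_ 0# 1#
    0≢1               : 0# ≢ 1#
    inverse           : ∀ x → x ≢ 0# → ∃[ y ] x * y ≡ 1#
    enumeration       : Carrier ↔ Fin order

  commutativeRing : CommutativeRing 0ℓ 0ℓ
  commutativeRing = record { isCommutativeRing = isCommutativeRing }

  open CommutativeRing commutativeRing public using (rawRing)
  open RawSemiringDefs (RawRing.rawSemiring rawRing) public using (_^_; sum; product)

-- Linear algebra in V with scalars restricted to a set K of elements of F.
-- It is used both with K = U (all of F) and with K a proper subfield.
module LinearAlgebra {order : ℕ} (F : FiniteField order)
                     (V : RawLeftModule (FiniteField.Carrier F) 0ℓ 0ℓ) where
  open FiniteField F using (Carrier; 0#)
  open RawLeftModule V

  sumᴹ : ∀ {m} → Vector Carrierᴹ m → Carrierᴹ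
  sumᴹ = sumₘ +ᴹ-rawMonoid

  combination : ∀ {m} → Vector Carrier m → Vector Carrierᴹ m → Carrierᴹ
  combination c v = sumᴹ λ i → c i *ₗ v i

  Span : Pred Carrier 0ℓ → ∀ {m} → Vector Carrierᴹ m → Pred Carrierᴹ 0ℓ
  Span K {m} v w = Σ[ c ∈ Vector Carrier m ] (∀ i → c i ∈ K) × combination c v ≈ᴹ w

  LinearlyIndependent : Pred Carrier 0ℓ → ∀ {m} → Vector Carrierᴹ m → Set
  LinearlyIndependent K {m} v =
    (c : Vector Carrier m) → (∀ i → c i ∈ K) → combination c v ≈ᴹ 0ᴹ → ∀ i → c i ≡ 0#

  HasDimension : Pred Carrier 0ℓ → Pred Carrierᴹ 0ℓ → ℕ → Set
  HasDimension K W d = Σ[ b ∈ Vector Carrierᴹ d ] LinearlyIndependent K b × W ≐ Span K b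

  IsSubspace : Pred Carrier 0ℓ → Pred Carrierᴹ 0ℓ → Set
  IsSubspace K W =
      0ᴹ ∈ W
    × (∀ {v w} → v ∈ W → w ∈ W → v +ᴹ w ∈ W)
    × (∀ {a v} → a ∈ K → v ∈ W → a *ₗ v ∈ W)

  IsDirectSum : Pred Carrierᴹ 0ℓ → Pred Carrierᴹ 0ℓ → Pred Carrierᴹ 0ℓ → Set
  IsDirectSum W A B =
      (W ≐ λ w → ∃₂ λ a b → a ∈ A × b ∈ B × a +ᴹ b ≈ᴹ w)
    × (∀ {v} → v ∈ A → v ∈ B → v ≈ᴹ 0ᴹ)

module LinearizedPolynomials (q n : ℕ) .{{_ : NonZero n}} (F : FiniteField (q ℕ.^ n)) where
  open FiniteField F

  -- The subfield of order q of F = 𝔽_{qⁿ}.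
  𝔽q : Pred Carrier 0ℓ
  𝔽q a = a ^ q ≡ a

  -- a^{[j]}. Since a^{qⁿ} = a on F, the j-th power of the q-Frobenius depends
  -- only on j mod n, which also gives it its meaning for negative j.
  frob : Carrier → ℤ → Carrier
  frob a j = a ^ (q ℕ.^ (j %ℕ n))

  norm : Carrier → Carrier
  norm η = product λ (i : Fin n) → η ^ (q ℕ.^ toℕ i)

  -- The vector (a₀ , … , aₙ₋₁) stands for Σᵢ aᵢ x^{[i]}.
  Lin : Set
  Lin = Vec Carrier n

  linSpace : RawLeftModule Carrier 0ℓ 0ℓ
  linSpace = record
    { Carrierᴹ = Lin
    ; _≈ᴹ_     = _≡_
    ; _+ᴹ_     = zipWith _+_
    ; _*ₗ_     = λ a → map (a *_)
    ; 0ᴹ       = replicate n 0#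
    ; -ᴹ_      = map -_
    }

  open RawLeftModule linSpace public using (_+ᴹ_; _*ₗ_; 0ᴹ; -ᴹ_)
  open LinearAlgebra F linSpace public

  -- F itself, as the space in which images of linearized polynomials live.
  module OverF = LinearAlgebra F (tensorUnit {R = rawRing})

  eval : Lin → Carrier → Carrier
  eval f x = sum λ i → lookup f i * x ^ (q ℕ.^ toℕ i)

  Image : Lin → Pred Carrier 0ℓ
  Image f y = ∃[ x ] eval f x ≡ y

  HasRank : Lin → ℕ → Set
  HasRank f r = OverF.HasDimension 𝔽q (Image f) r

  U₁ : Pred Lin 0ℓ
  U₁ f = ∃[ r ] r ≤ 1 × HasRank f r

  -- a x^{[j]}, with j read modulo n.
  monomial : Carrier → ℤ → Lin
  monomial a j = replicate n 0# [ fromℕ< (n%ℕd<d j n) ]≔ a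

  x^[_] : ℤ → Lin
  x^[ j ] = monomial 1# j

  infixl 9 _^[_]
  _^[_] : Lin → ℤ → Lin
  f ^[ j ] = sumᴹ λ i → monomial (frob (lookup f i) j) (+ toℕ i +ℤ j)

  -- Composition modulo x^{qⁿ} - x: if f = Σᵢ aᵢ x^{[i]}, then f ∘ g = Σᵢ aᵢ g^{[i]}.
  infixr 9 _∘ᴸ_
  _∘ᴸ_ : Lin → Lin → Lin
  f ∘ᴸ g = sumᴹ λ i → lookup f i *ₗ g ^[ + toℕ i ]

  Invertible : Lin → Set
  Invertible f = ∃[ g ] f ∘ᴸ g ≡ x^[ + 0 ] × g ∘ᴸ f ≡ x^[ + 0 ]

  Code : Set₁
  Code = Pred Lin 0ℓ

  infixl 9 _^⟨_⟩
  _^⟨_⟩ : Code → ℤ → Code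
  (C ^⟨ j ⟩) g = ∃[ f ] f ∈ C × f ^[ j ] ≡ g

  IsMinimumDistance : Code → ℕ → Set
  IsMinimumDistance C d =
      (∃₂ λ f g → f ∈ C × g ∈ C × f ≢ g × HasRank (f +ᴹ -ᴹ g) d)
    × (∀ {f g r} → f ∈ C → g ∈ C → f ≢ g → HasRank (f +ᴹ -ᴹ g) r → d ≤ r)

  HasSize : Code → ℕ → Set
  HasSize C m = Σ[ e ∈ (Fin m → Lin) ] Injective _≡_ _≡_ e × C ≐ λ f → ∃[ i ] e i ≡ f

  -- d ≤ n for every minimum distance d, so the truncated subtraction is genuine.
  IsMRD : Code → Set
  IsMRD C =
      IsSubspace 𝔽q C
    × ∃[ d ] IsMinimumDistance C d × HasSize C (q ℕ.^ (n ℕ.* (n ∸ d ℕ.+ 1)))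

  open RingMorphisms rawRing rawRing using (IsRingIsomorphism)

  Equivalent : Code → Code → Set
  Equivalent C C′ =
    ∃₂ λ h g → Σ[ σ ∈ (Carrier → Carrier) ]
        Invertible h × Invertible g × IsRingIsomorphism σ
      × (λ f′ → ∃[ f ] f ∈ C × h ∘ᴸ map σ f ∘ᴸ g ≡ f′) ≐ C′

  -- p^{[s]} , p^{[2s]} , … , p^{[sm]}
  iterates : Lin → ℤ → (m : ℕ) → Vector Lin m
  iterates p s m i = p ^[ s *ℤ + ℕ.suc (toℕ i) ]

  -- x + η x^{[sk]} , x^{[s]} , … , x^{[s(k-1)]}
  generators : (k : ℕ) → ℤ → Carrier → Vector Lin k
  generators k s η zero    = x^[ + 0 ] +ᴹ η *ₗ x^[ s *ℤ + k ]
  generators k s η (suc i) = x^[ s *ℤ + ℕ.suc (toℕ i) ]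

  ℋ : (k : ℕ) → ℤ → Carrier → Code
  ℋ k s η = Span U (generators k s η)

{-# OPTIONS --safe #-}
module Submission where

-- Writing w = p + η p^{[sk]}, the word w has a nonzero component along r (else a nonzero
-- word of ℋ(η) would vanish on F), so C = ⟨w, p^{[s]}, …, p^{[s(k-1)]}⟩ = ℋ(η) ∘ p, and
-- composition with p⁻¹ is the equivalence. For the rank, read a word of ℋ(η) as a
-- polynomial a₀ + a₁σ + … + a_kσᵏ in σ = x^{[s]}, whose fixed field is 𝔽q. A root u ≠ 0
-- splits off a right factor σ - σ(u)/u with a kernel of q elements and with
-- N(σ(u)/u) = 1. By induction such a polynomial has at most qᵏ roots, and at most qᵏ⁻¹
-- unless N(a₀) = (-1)^{nk} N(a_k), which the condition on N(η) excludes when a₀ ≠ 0, as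
-- a_k = a₀η; when a₀ = 0 the degree is less than k. Thus nonzero words have rank > n - k.

open import Defs
open import Level using (0ℓ)
open import Algebra.Bundles using (CommutativeMonoid; CommutativeRing)
open import Algebra.Module.Bundles.Raw using (RawLeftModule)
open import Algebra.Module.Construct.TensorUnit using () renaming (rawLeftModule to tensorUnit)
import Algebra.Morphism.Construct.Identity as Identity
import Algebra.Properties.AbelianGroup as GroupProperties
import Algebra.Properties.CommutativeMonoid.Sum as MonoidSum
import Algebra.Properties.CommutativeSemiring.Binomial as Binomial
import Algebra.Properties.CommutativeSemiring.Exp as Exp
import Algebra.Properties.Ring as RingProperties
import Algebra.Properties.Semiring.Mult as Mult
import Algebra.Properties.Semiring.Sum as Sum
import Algebra.Solver.Ring.NaturalCoefficients.Default as Solver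
open import Data.Fin.Base as Fin using
  (Fin; zero; suc; toℕ; fromℕ<; inject₁; punchIn; finToFun; funToFin; combine)
open import Data.Fin.Permutation using (Permutation′)
import Data.Fin.Properties as Fin
open import Data.Integer.Base as ℤ using (ℤ; _%ℕ_; _/ℕ_; ∣_∣)
import Data.Integer.Divisibility.Signed as ℤ
open import Data.Integer.DivMod using (a≡a%ℕn+[a/ℕn]*n; n%ℕd<d)
import Data.Integer.GCD as ℤ
import Data.Integer.Properties as ℤ
import Data.Integer.Solver as ℤSolver
open import Data.Nat.Base as ℕ using (ℕ; zero; suc; _≤_; _<_; z≤n; s≤s; _∸_; NonZero)
open import Data.Nat.Combinatorics using (nCn≡1; nC1≡n; k>n⇒nCk≡0; nCk+nC[k+1]≡[n+1]C[k+1])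
  renaming (_C_ to _choose_)
open import Data.Nat.Divisibility as ℕ using (_∣_; divides; ∣⇒≤; m∣m*n)
import Data.Nat.GCD as ℕ
open import Data.Nat.Primality using (Prime; euclidsLemma; prime⇒nonZero; prime⇒nonTrivial)
import Data.Nat.Properties as ℕ
open import Data.Product.Base using (∃; ∃-syntax; _×_; _,_; proj₁; proj₂)
open import Data.Sum.Base using (inj₁; inj₂; [_,_]′)
open import Data.Vec.Base using
  (Vec; []; _∷_; _∷ʳ_; head; last; lookup; map; replicate; tabulate)
open import Data.Vec.Functional as Vector using (Vector)
open import Data.Vec.Properties using
  ( ∷-injectiveˡ; ∷-injectiveʳ; ≡-dec; last-∷ʳ; lookup-map; lookup-replicate; lookup-zipWith
  ; lookup∘tabulate; lookup∘updateAt; lookup∘updateAt′; map-id; tabulate-cong; tabulate∘lookup)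
open import Function.Base using (_∘_; id)
open import Function.Bundles using (_↔_; Inverse; mk↔ₛ′)
open import Function.Construct.Composition using (_↔-∘_)
open import Function.Construct.Symmetry using (↔-sym)
open import Function.Definitions using (Injective)
open import Function.Properties.Inverse using (↔⇒↣)
open import Relation.Binary.Definitions using (DecidableEquality)
open import Relation.Binary.PropositionalEquality
open import Relation.Nullary using (Dec; yes; no; ¬_; ¬?; contradiction)
open import Relation.Nullary.Decidable using (_×-dec_; decidable-stable; map′; via-injection)
open import Relation.Unary using (Pred; Decidable; _∈_; _∩_; _≐_; ｛_｝; U)

open import Algebra.Properties.Semiring.Sum ℕ.+-*-semiring as ℕSum using () renaming (sum to sumℕ)

-- Sizes replace dimensions throughout. A kernel, a fibre, a span or a code is counted through an
-- enumeration of F, and powers of q are compared where linear algebra would compare exponents. Two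
-- consequences shape the development. First, `𝔽q` is given only by the equation x^q = x, so that it
-- has q elements must be proved: the polynomial X^q - X gives one inequality, and the skew root
-- bound applied to σⁿ - 1, which vanishes on all of F, gives the other. Second, an element of `Lin`
-- is determined by its values, so every identity between codewords, composites or twists is checked
-- pointwise. The norm condition works because a skew polynomial of degree k that splits completely
-- into factors σ - c with N(c) = 1 must satisfy N(a₀) = N(-1)^k N(a_k). If this equality fails, the
-- splitting has to stop at a factor without nonzero roots, and one power of q is saved. The saved
-- power is what makes a word with k + 2 coefficients obey the bound for k + 1 coefficients.

-- Counting in finite sets by sums of indicators.

indicator : ∀ {P : Set} → Dec P → ℕ
indicator (yes _) = 1
indicator (no  _) = 0

indicator-mono : ∀ {P Q : Set} (P? : Dec P) (Q? : Dec Q) → (P → Q) → indicator P? ≤ indicator Q?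
indicator-mono (yes _) (yes _) _  = ℕ.≤-refl
indicator-mono (yes p) (no ¬q) pq = contradiction (pq p) ¬q
indicator-mono (no  _) _       _  = z≤n

indicator-yes : ∀ {P : Set} (P? : Dec P) → P → indicator P? ≡ 1
indicator-yes (yes _) _ = refl
indicator-yes (no ¬p) p = contradiction p ¬p

indicator-no : ∀ {P : Set} (P? : Dec P) → ¬ P → indicator P? ≡ 0
indicator-no (yes p) ¬p = contradiction p ¬p
indicator-no (no _)  _  = refl

sum-mono : ∀ {m} {f g : Fin m → ℕ} → (∀ i → f i ≤ g i) → sumℕ f ≤ sumℕ g
sum-mono {zero}  _   = z≤n
sum-mono {suc m} f≤g = ℕ.+-mono-≤ (f≤g zero) (sum-mono (f≤g ∘ suc))

term≤sum : ∀ {m} (f : Fin m → ℕ) i → f i ≤ sumℕ f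
term≤sum f zero    = ℕ.m≤m+n _ _
term≤sum f (suc i) = ℕ.≤-trans (term≤sum (f ∘ suc) i) (ℕ.m≤n+m _ _)

sum-ones : ∀ m → sumℕ {m} (λ _ → 1) ≡ m
sum-ones zero    = refl
sum-ones (suc m) = cong suc (sum-ones m)

sum-indicator-≤1 : ∀ {m} {P : Pred (Fin m) 0ℓ} (P? : Decidable P) →
                   (∀ {i j} → P i → P j → i ≡ j) → sumℕ (λ i → indicator (P? i)) ≤ 1
sum-indicator-≤1 {zero}  P? _ = z≤n
sum-indicator-≤1 {suc m} P? unique with P? zero
... | yes p = s≤s (ℕ.≤-reflexive (trans
                (ℕSum.sum-cong-≗ λ i → indicator-no (P? (suc i)) λ q → Fin.0≢1+n (unique p q))
                (ℕSum.sum-replicate-zero m)))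
... | no  _ = sum-indicator-≤1 (P? ∘ suc) λ p q → Fin.suc-injective (unique p q)

-- The list is indexed by the indicator sum itself, so that a value computed for the count, such as
-- q for `𝔽q`, can later be substituted into its type.
enumerate : ∀ {m} {P : Pred (Fin m) 0ℓ} (P? : Decidable P) →
  ∃ λ (e : Fin (sumℕ λ i → indicator (P? i)) → Fin m) →
    Injective _≡_ _≡_ e × (∀ j → P (e j)) × (∀ {i} → P i → ∃ λ j → e j ≡ i)
enumerate {zero}  P? = (λ ()) , (λ {}) , (λ ()) , λ {}
enumerate {suc m} P? with P? zero | enumerate (P? ∘ suc)
... | no ¬p | e , injective , sound , complete = suc ∘ e , injective ∘ Fin.suc-injective , sound ,
  λ { {zero}  p → contradiction p ¬p
    ; {suc i} p → let (j , eq) = complete p in j , cong suc eq }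
... | yes p | e , injective , sound , complete =
    (λ where zero → zero ; (suc j) → suc (e j))
  , (λ { {zero}  {zero}  _  → refl
       ; {suc _} {suc _} eq → cong suc (injective (Fin.suc-injective eq)) })
  , (λ where zero → p ; (suc j) → sound j)
  , λ { {zero}  _ → zero , refl
      ; {suc i} q → let (j , eq) = complete q in suc j , cong suc eq }

module Counting {A : Set} {N : ℕ} (enumeration : A ↔ Fin N) where
  open Inverse enumeration using (to; from; strictlyInverseˡ; strictlyInverseʳ)

  infix 4 _≟_
  _≟_ : DecidableEquality A
  _≟_ = via-injection (↔⇒↣ enumeration) Fin._≟_

  to-injective : Injective _≡_ _≡_ to
  to-injective {x} {y} eq = trans (sym (strictlyInverseʳ x)) (trans (cong from eq) (strictlyInverseʳ y))

  from-injective : Injective _≡_ _≡_ from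
  from-injective {x} {y} eq = trans (sym (strictlyInverseˡ x)) (trans (cong to eq) (strictlyInverseˡ y))

  -- Exhaustive search over the enumeration. It supplies constructively the case distinctions on
  -- whether a root, a preimage or a vector outside a span exists.
  find : ∀ {P : Pred A 0ℓ} → Decidable P → Dec (∃ P)
  find {P} P? = map′ (λ (i , p) → from i , p)
                     (λ (x , p) → to x , subst P (sym (strictlyInverseʳ x)) p)
                     (Fin.any? (P? ∘ from))

  ∑ : (A → ℕ) → ℕ
  ∑ f = sumℕ (f ∘ from)

  # : ∀ {P : Pred A 0ℓ} → Decidable P → ℕ
  # P? = ∑ λ x → indicator (P? x)

  toPermutation : A ↔ A → Permutation′ N
  toPermutation π = enumeration ↔-∘ (π ↔-∘ ↔-sym enumeration)

  ∑-cong : ∀ {f g : A → ℕ} → (∀ x → f x ≡ g x) → ∑ f ≡ ∑ g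
  ∑-cong f≗g = ℕSum.sum-cong-≗ (f≗g ∘ from)

  ∑-mono : ∀ {f g : A → ℕ} → (∀ x → f x ≤ g x) → ∑ f ≤ ∑ g
  ∑-mono f≤g = sum-mono (f≤g ∘ from)

  -- Change of variables. It is applied to translations, to scalings and finally to the bijection x
  -- ↦ `eval p x`.
  ∑-permute : ∀ (π : A ↔ A) f → ∑ f ≡ ∑ (f ∘ Inverse.to π)
  ∑-permute π f = trans (ℕSum.sum-permute (f ∘ from) (toPermutation π))
    (ℕSum.sum-cong-≗ {N} λ i → cong f (strictlyInverseʳ (Inverse.to π (from i))))

  ∑-comm : ∀ (f : A → A → ℕ) → ∑ (λ x → ∑ (f x)) ≡ ∑ λ y → ∑ λ x → f x y
  ∑-comm f = ℕSum.∑-comm {N} {N} λ i j → f (from i) (from j)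

  ∑-ones : ∑ (λ _ → 1) ≡ N
  ∑-ones = sum-ones N

  ∑-+ : ∀ f g → ∑ (λ x → f x ℕ.+ g x) ≡ ∑ f ℕ.+ ∑ g
  ∑-+ f g = ℕSum.∑-distrib-+ (f ∘ from) (g ∘ from)

  ∑-*ʳ : ∀ f c → ∑ (λ x → f x ℕ.* c) ≡ ∑ f ℕ.* c
  ∑-*ʳ f c = sym (ℕSum.*-distribʳ-sum c (f ∘ from))

  #-mono : ∀ {P Q : Pred A 0ℓ} (P? : Decidable P) (Q? : Decidable Q) → (∀ {x} → P x → Q x) → # P? ≤ # Q?
  #-mono P? Q? P⊆Q = ∑-mono λ x → indicator-mono (P? x) (Q? x) P⊆Q

  #-cong : ∀ {P Q : Pred A 0ℓ} (P? : Decidable P) (Q? : Decidable Q) →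
           (∀ {x} → P x → Q x) → (∀ {x} → Q x → P x) → # P? ≡ # Q?
  #-cong P? Q? P⊆Q Q⊆P = ℕ.≤-antisym (#-mono P? Q? P⊆Q) (#-mono Q? P? Q⊆P)

  #-all : ∀ {P : Pred A 0ℓ} (P? : Decidable P) → (∀ x → P x) → # P? ≡ N
  #-all P? all = trans (∑-cong λ x → indicator-yes (P? x) (all x)) ∑-ones

  1≤# : ∀ {P : Pred A 0ℓ} (P? : Decidable P) {x} → P x → 1 ≤ # P?
  1≤# {P} P? {x} p = subst (_≤ # P?) (indicator-yes (P? _) (subst P (sym (strictlyInverseʳ x)) p))
    (term≤sum (λ i → indicator (P? (from i))) (to x))

  #-unique : ∀ {P : Pred A 0ℓ} (P? : Decidable P) → (∀ {x y} → P x → P y → x ≡ y) → # P? ≤ 1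
  #-unique P? unique = sum-indicator-≤1 (P? ∘ from) λ p q → from-injective (unique p q)

  #-singleton : ∀ a → # (a ≟_) ≡ 1
  #-singleton a = ℕ.≤-antisym (#-unique (a ≟_) λ p q → trans (sym p) q) (1≤# (a ≟_) refl)

  ∑-δ : ∀ a (g : A → ℕ) → ∑ (λ y → indicator (a ≟ y) ℕ.* g y) ≡ g a
  ∑-δ a g = begin
    ∑ (λ y → indicator (a ≟ y) ℕ.* g y) ≡⟨ ∑-cong {g = λ y → indicator (a ≟ y) ℕ.* g a} pointwise ⟩
    ∑ (λ y → indicator (a ≟ y) ℕ.* g a) ≡⟨ ∑-*ʳ (λ y → indicator (a ≟ y)) (g a) ⟩
    # (a ≟_) ℕ.* g a                    ≡⟨ cong (ℕ._* g a) (#-singleton a) ⟩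
    1 ℕ.* g a                           ≡⟨ ℕ.*-identityˡ _ ⟩
    g a                                 ∎
    where
    open ≡-Reasoning
    pointwise : ∀ y → indicator (a ≟ y) ℕ.* g y ≡ indicator (a ≟ y) ℕ.* g a
    pointwise y with a ≟ y
    ... | yes refl = refl
    ... | no  _    = refl

  module _ {P : Pred A 0ℓ} (P? : Decidable P) {m} (e : Fin m → A) where

    private
      -- The pairs (i, x) with e i ≡ x are counted in both orders. The inner sum over i is at most 1
      -- when `e` is injective and at least 1 wherever `e` covers, which gives the two bounds below.
      doubleCount : m ≡ ∑ λ x → sumℕ λ i → indicator (e i ≟ x)
      doubleCount = begin
        m                                          ≡⟨ sum-ones m ⟨
        sumℕ (λ (i : Fin m) → 1)                   ≡⟨ ℕSum.sum-cong-≗ (λ i → #-singleton (e i)) ⟨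
        sumℕ (λ i → ∑ λ x → indicator (e i ≟ x))
          ≡⟨ ℕSum.∑-comm {m} {N} (λ i j → indicator (e i ≟ from j)) ⟩
        ∑ (λ x → sumℕ λ i → indicator (e i ≟ x))   ∎
        where open ≡-Reasoning

    injection⇒≤# : Injective _≡_ _≡_ e → (∀ i → P (e i)) → m ≤ # P?
    injection⇒≤# injective inP = subst (_≤ # P?) (sym doubleCount) (∑-mono bound)
      where
      bound : ∀ x → sumℕ (λ i → indicator (e i ≟ x)) ≤ indicator (P? x)
      bound x with P? x
      ... | yes _ = sum-indicator-≤1 (λ i → e i ≟ x) λ p q → injective (trans p (sym q))
      ... | no ¬p = ℕ.≤-reflexive (trans
              (ℕSum.sum-cong-≗ λ i → indicator-no (e i ≟ x) λ eq → ¬p (subst P eq (inP i)))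
              (ℕSum.sum-replicate-zero m))

    cover⇒#≤ : (∀ {x} → P x → ∃ λ i → e i ≡ x) → # P? ≤ m
    cover⇒#≤ cover = subst (# P? ≤_) (sym doubleCount) (∑-mono bound)
      where
      bound : ∀ x → indicator (P? x) ≤ sumℕ (λ i → indicator (e i ≟ x))
      bound x with P? x
      ... | yes p = let (i , eq) = cover p in
              subst (_≤ sumℕ (λ i → indicator (e i ≟ x))) (indicator-yes (e i ≟ x) eq)
                (term≤sum (λ i → indicator (e i ≟ x)) i)
      ... | no _  = z≤n

  #-fibres : ∀ {P : Pred A 0ℓ} (P? : Decidable P) (τ : A → A) →
             # (P? ∘ τ) ≡ ∑ λ y → indicator (P? y) ℕ.* # λ x → τ x ≟ y
  #-fibres P? τ = begin
    ∑ (λ x → indicator (P? (τ x)))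
      -- A Kronecker delta at `τ x` is inserted, so that exchanging the two sums sorts the x by
      -- their image.
      ≡⟨ ∑-cong (λ x → ∑-δ (τ x) (λ y → indicator (P? y))) ⟨
    ∑ (λ x → ∑ λ y → indicator (τ x ≟ y) ℕ.* indicator (P? y))
      ≡⟨ ∑-comm (λ x y → indicator (τ x ≟ y) ℕ.* indicator (P? y)) ⟩
    ∑ (λ y → ∑ λ x → indicator (τ x ≟ y) ℕ.* indicator (P? y))
      ≡⟨ ∑-cong (λ y → trans (∑-*ʳ (λ x → indicator (τ x ≟ y)) (indicator (P? y)))
                       (ℕ.*-comm (# λ x → τ x ≟ y) (indicator (P? y)))) ⟩
    ∑ (λ y → indicator (P? y) ℕ.* # λ x → τ x ≟ y)
      ∎
    where open ≡-Reasoning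

  #-enumerate : ∀ {P : Pred A 0ℓ} (P? : Decidable P) →
    ∃ λ (e : Fin (# P?) → A) → Injective _≡_ _≡_ e × (∀ j → P (e j)) × (∀ {x} → P x → ∃ λ j → e j ≡ x)
  #-enumerate {P} P? = let (e , injective , sound , complete) = enumerate (P? ∘ from) in
    from ∘ e , injective ∘ from-injective , sound ,
    λ {x} p → let (j , eq) = complete (subst P (sym (strictlyInverseʳ x)) p) in
      j , trans (cong from eq) (strictlyInverseʳ x)

-- Divisibility of binomial coefficients by a prime.

-- With `suc n` prime, the right side displays it as a factor of the left, and Euclid's lemma moves
-- it onto the binomial coefficient. The induction uses Pascal's rule twice: to split the left side
-- and to reassemble the right.
absorption : ∀ n k → suc k ℕ.* (suc n choose suc k) ≡ suc n ℕ.* (n choose k)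
absorption zero zero = refl
absorption zero (suc k) = trans
  (cong (suc (suc k) ℕ.*_) (k>n⇒nCk≡0 {1} {suc (suc k)} (s≤s (s≤s z≤n))))
  (trans (ℕ.*-zeroʳ k) (sym (cong (1 ℕ.*_) (k>n⇒nCk≡0 {0} {suc k} (s≤s z≤n)))))
absorption (suc n) zero = begin
  1 ℕ.* (suc (suc n) choose 1)   ≡⟨ ℕ.*-identityˡ _ ⟩
  suc (suc n) choose 1           ≡⟨ nC1≡n (suc (suc n)) ⟩
  suc (suc n)               ≡⟨ ℕ.*-identityʳ _ ⟨
  suc (suc n) ℕ.* 1         ∎
  where open ≡-Reasoning
absorption (suc n) (suc k) = begin
  suc (suc k) ℕ.* (suc (suc n) choose suc (suc k))
    ≡⟨ cong (suc (suc k) ℕ.*_) (nCk+nC[k+1]≡[n+1]C[k+1] (suc n) (suc k)) ⟨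
  suc (suc k) ℕ.* (c ℕ.+ (suc n choose suc (suc k)))
    ≡⟨ ℕ.*-distribˡ-+ (suc (suc k)) c _ ⟩
  (c ℕ.+ suc k ℕ.* c) ℕ.+ suc (suc k) ℕ.* (suc n choose suc (suc k))
    ≡⟨ cong₂ (λ a b → (c ℕ.+ a) ℕ.+ b) (absorption n k) (absorption n (suc k)) ⟩
  (c ℕ.+ suc n ℕ.* (n choose k)) ℕ.+ suc n ℕ.* (n choose suc k)
    ≡⟨ ℕ.+-assoc c _ _ ⟩
  c ℕ.+ (suc n ℕ.* (n choose k) ℕ.+ suc n ℕ.* (n choose suc k))
    ≡⟨ cong (c ℕ.+_) (ℕ.*-distribˡ-+ (suc n) (n choose k) _) ⟨
  c ℕ.+ suc n ℕ.* ((n choose k) ℕ.+ (n choose suc k))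
    ≡⟨ cong (λ d → c ℕ.+ suc n ℕ.* d) (nCk+nC[k+1]≡[n+1]C[k+1] n k) ⟩
  suc (suc n) ℕ.* c
    ∎
  where
  open ≡-Reasoning
  c = suc n choose suc k

prime∣binomial : ∀ {p k} → Prime p → 0 < k → k < p → p ∣ p choose k
prime∣binomial {suc p} {suc k} p-prime _ k<p
  with euclidsLemma (suc k) (suc p choose suc k) p-prime
         (subst (suc p ∣_) (sym (absorption p k)) (m∣m*n (p choose k)))
... | inj₁ p∣k = contradiction (∣⇒≤ p∣k) (ℕ.<⇒≱ k<p)
... | inj₂ p∣C = p∣C

module _ {c} (M : CommutativeMonoid c 0ℓ) where
  open CommutativeMonoid M using (Carrier; _≈_; ε; ∙-congˡ; identityʳ) renaming (trans to ≈-trans)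
  open MonoidSum M using (sum; sum-remove; sum-cong-≋; sum-replicate-zero)

  sum-single : ∀ {m} (t : Fin m → Carrier) k → (∀ i → i ≢ k → t i ≈ ε) → sum t ≈ t k
  sum-single {suc m} t k others = ≈-trans (sum-remove {i = k} t) (≈-trans
    (∙-congˡ (≈-trans (sum-cong-≋ λ i → others (punchIn k i) (Fin.punchInᵢ≢i k i))
        (sum-replicate-zero m)))
    (identityʳ _))

-- Finite fields: characteristic, Frobenius, kernels of additive maps.

module FieldProperties {order} (F : FiniteField order) where
  open FiniteField F public
  open CommutativeRing commutativeRing public using
    ( +-assoc; +-comm; +-identityˡ; +-identityʳ; -‿inverseˡ; -‿inverseʳ
    ; *-assoc; *-comm; *-identityˡ; *-identityʳ; distribˡ; distribʳ; zeroˡ; zeroʳ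
    ; commutativeSemiring; semiring; ring; +-abelianGroup; +-commutativeMonoid; *-commutativeMonoid)
  open RingProperties ring public using (-‿distribˡ-*; -‿distribʳ-*; -1*x≈-x)
  open GroupProperties +-abelianGroup public
    using ( inverseˡ-unique; inverseʳ-unique; ∙-cancelˡ; ∙-cancelʳ; x∙y⁻¹≈ε⇒x≈y
          ; ⁻¹-involutive; ε⁻¹≈ε; ⁻¹-∙-comm)
  open Exp commutativeSemiring public using (^-assocʳ; ^-distrib-*)
  open Mult semiring using (×1-homo-*; ×-assoc-*; ×-assocˡ) renaming (_×_ to _·_)
  open Sum semiring public
    using (sum-cong-≗; *-distribˡ-sum; ∑-distrib-+; sum-replicate-zero; sum-init-last)
  module Prod = MonoidSum *-commutativeMonoid
  open Counting enumeration public
  private module Enum = Inverse enumeration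
  open Solver commutativeSemiring public using (solve; _:=_; _:+_; _:*_; con)

  _⁻¹ : ∀ {x} → x ≢ 0# → Carrier
  x≢0 ⁻¹ = proj₁ (inverse _ x≢0)

  *-inverseʳ : ∀ {x} (x≢0 : x ≢ 0#) → x * x≢0 ⁻¹ ≡ 1#
  *-inverseʳ x≢0 = proj₂ (inverse _ x≢0)

  *-inverseˡ : ∀ {x} (x≢0 : x ≢ 0#) → x≢0 ⁻¹ * x ≡ 1#
  *-inverseˡ x≢0 = trans (*-comm _ _) (*-inverseʳ x≢0)

  *-cancelˡ : ∀ {a x y} → a ≢ 0# → a * x ≡ a * y → x ≡ y
  *-cancelˡ {a} {x} {y} a≢0 eq = begin
    x                     ≡⟨ trans (cong (_* x) (*-inverseˡ a≢0)) (*-identityˡ x) ⟨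
    a≢0 ⁻¹ * a * x        ≡⟨ *-assoc _ a x ⟩
    a≢0 ⁻¹ * (a * x)      ≡⟨ cong (a≢0 ⁻¹ *_) eq ⟩
    a≢0 ⁻¹ * (a * y)      ≡⟨ *-assoc _ a y ⟨
    a≢0 ⁻¹ * a * y        ≡⟨ trans (cong (_* y) (*-inverseˡ a≢0)) (*-identityˡ y) ⟩
    y                     ∎
    where open ≡-Reasoning

  *≡0 : ∀ {a x} → a ≢ 0# → a * x ≡ 0# → x ≡ 0#
  *≡0 a≢0 eq = *-cancelˡ a≢0 (trans eq (sym (zeroʳ _)))

  *-≢0 : ∀ {a x} → a ≢ 0# → x ≢ 0# → a * x ≢ 0#
  *-≢0 a≢0 x≢0 eq = x≢0 (*≡0 a≢0 eq)

  -1≢0 : - 1# ≢ 0#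
  -1≢0 eq = 0≢1 (trans (sym ε⁻¹≈ε) (trans (cong -_ (sym eq)) (⁻¹-involutive 1#)))

  ^≡0 : ∀ {x} m → x ^ m ≡ 0# → x ≡ 0#
  ^≡0 zero    eq = contradiction (sym eq) 0≢1
  ^≡0 {x} (suc m) eq with x ≟ 0#
  ... | yes x≡0 = x≡0
  ... | no  x≢0 = ^≡0 m (*≡0 x≢0 eq)

  1^ : ∀ m → 1# ^ m ≡ 1#
  1^ zero    = refl
  1^ (suc m) = trans (*-identityˡ _) (1^ m)

  translation : Carrier → Carrier ↔ Carrier
  translation a = mk↔ₛ′ (_+ a) (_+ - a) (cancel (-‿inverseˡ a)) (cancel (-‿inverseʳ a))
    where
    cancel : ∀ {b c} → b + c ≡ 0# → ∀ x → x + b + c ≡ x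
    cancel {b} {c} eq x = trans (+-assoc x b c) (trans (cong (x +_) eq) (+-identityʳ x))

  scaling : ∀ {a} → a ≢ 0# → Carrier ↔ Carrier
  scaling {a} a≢0 = mk↔ₛ′ (a *_) (a≢0 ⁻¹ *_) (cancel (*-inverseʳ a≢0)) (cancel (*-inverseˡ a≢0))
    where
    cancel : ∀ {b c} → b * c ≡ 1# → ∀ x → b * (c * x) ≡ x
    cancel {b} {c} eq x = trans (sym (*-assoc b c x)) (trans (cong (_* x) eq) (*-identityˡ x))

  -- Translation by 1 permutes F, so the sum of all elements is unchanged when `order` copies of 1
  -- are added to it.
  order×1≡0 : order · 1# ≡ 0#
  order×1≡0 = ∙-cancelˡ total _ _ (sym (begin
    total + 0#                                      ≡⟨ +-identityʳ total ⟩
    total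
      ≡⟨ Sum.sum-permute semiring Enum.from (toPermutation (translation 1#)) ⟩
    sum (λ i → Enum.from (Enum.to (Enum.from i + 1#)))
      ≡⟨ sum-cong-≗ {order} (λ i → Enum.strictlyInverseʳ (Enum.from i + 1#)) ⟩
    sum (λ i → Enum.from i + 1#)                    ≡⟨ ∑-distrib-+ {order} Enum.from (λ _ → 1#) ⟩
    total + sum {order} (λ _ → 1#)
      ≡⟨ cong (total +_) (Sum.sum-replicate semiring order) ⟩
    total + order · 1#                              ∎))
    where
    open ≡-Reasoning
    total = sum Enum.from

  -- `order · 1#` is the m-th power of `p · 1#`, and a field has no nonzero nilpotents.
  prime-characteristic : ∀ {p} m → order ≡ p ℕ.^ m → p · 1# ≡ 0#
  prime-characteristic {p} m eq = ^≡0 m (trans (power m) (trans (cong (_· 1#) (sym eq)) order×1≡0))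
    where
    power : ∀ m → (p · 1#) ^ m ≡ (p ℕ.^ m) · 1#
    power zero    = sym (+-identityʳ 1#)
    power (suc m) = trans (cong ((p · 1#) *_) (power m)) (sym (×1-homo-* p (p ℕ.^ m)))

  multiple≡0 : ∀ {p} m x → p · 1# ≡ 0# → p ∣ m → m · x ≡ 0#
  multiple≡0 {p} _ x p×1≡0 (divides d refl) = begin
    (d ℕ.* p) · x      ≡⟨ cong (_· x) (ℕ.*-comm d p) ⟩
    (p ℕ.* d) · x      ≡⟨ ×-assocˡ x p d ⟨
    p · (d · x)        ≡⟨ cong (p ·_) (*-identityˡ _) ⟨
    p · (1# * (d · x)) ≡⟨ ×-assoc-* p 1# (d · x) ⟨
    (p · 1#) * (d · x) ≡⟨ cong (_* (d · x)) p×1≡0 ⟩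
    0# * (d · x)       ≡⟨ zeroˡ _ ⟩
    0#                 ∎
    where open ≡-Reasoning

  -- Only the two extreme terms of the binomial expansion survive; every coefficient in between is a
  -- multiple of p.
  ^p-distrib-+ : ∀ {p} → Prime p → p · 1# ≡ 0# → ∀ x y → (x + y) ^ p ≡ x ^ p + y ^ p
  ^p-distrib-+ {suc p} p-prime p×1≡0 x y = begin
    (x + y) ^ suc p               ≡⟨ Binomial.theorem commutativeSemiring (suc p) x y ⟩
    term zero + sum (term ∘ suc)  ≡⟨ cong (term zero +_) (sum-init-last (term ∘ suc)) ⟩
    term zero + (sum {p} (λ i → term (suc (inject₁ i))) + term (suc (Fin.fromℕ p)))
      ≡⟨ cong₂ (λ a b → a + (sum {p} (λ i → term (suc (inject₁ i))) + b)) first-term last-term ⟩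
    y ^ suc p + (sum {p} (λ i → term (suc (inject₁ i))) + x ^ suc p)
      ≡⟨ cong (λ a → y ^ suc p + (a + x ^ suc p))
              (trans (sum-cong-≗ {p} middle-term) (sum-replicate-zero p)) ⟩
    y ^ suc p + (0# + x ^ suc p)  ≡⟨ cong (y ^ suc p +_) (+-identityˡ _) ⟩
    y ^ suc p + x ^ suc p         ≡⟨ +-comm _ _ ⟩
    x ^ suc p + y ^ suc p         ∎
    where
    open ≡-Reasoning
    term : Fin (suc (suc p)) → Carrier
    term k = (suc p choose toℕ k) · (x ^ toℕ k * y ^ (suc p ℕ.∸ toℕ k))
    first-term : term zero ≡ y ^ suc p
    first-term = trans (+-identityʳ _) (*-identityˡ _)
    last-term : term (suc (Fin.fromℕ p)) ≡ x ^ suc p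
    last-term rewrite Fin.toℕ-fromℕ p | nCn≡1 (suc p) | ℕ.n∸n≡0 p = trans (+-identityʳ _) (*-identityʳ _)
    middle-term : ∀ i → term (suc (inject₁ i)) ≡ 0#
    middle-term i = multiple≡0 _ _ p×1≡0 (prime∣binomial p-prime (s≤s z≤n)
      (s≤s (subst (_< p) (sym (Fin.toℕ-inject₁ i)) (Fin.toℕ<n i))))

  ^pᵉ-distrib-+ : ∀ {p} → Prime p → p · 1# ≡ 0# → ∀ e x y →
      (x + y) ^ (p ℕ.^ e) ≡ x ^ (p ℕ.^ e) + y ^ (p ℕ.^ e)
  ^pᵉ-distrib-+ p-prime p×1≡0 zero x y =
      trans (*-identityʳ _) (sym (cong₂ _+_ (*-identityʳ x) (*-identityʳ y)))
  ^pᵉ-distrib-+ {p} p-prime p×1≡0 (suc e) x y = begin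
    (x + y) ^ (p ℕ.* p ℕ.^ e)                    ≡⟨ ^-assocʳ (x + y) p (p ℕ.^ e) ⟨
    ((x + y) ^ p) ^ (p ℕ.^ e)
      ≡⟨ cong (_^ (p ℕ.^ e)) (^p-distrib-+ p-prime p×1≡0 x y) ⟩
    (x ^ p + y ^ p) ^ (p ℕ.^ e)                  ≡⟨ ^pᵉ-distrib-+ p-prime p×1≡0 e (x ^ p) (y ^ p) ⟩
    (x ^ p) ^ (p ℕ.^ e) + (y ^ p) ^ (p ℕ.^ e)
      ≡⟨ cong₂ _+_ (^-assocʳ x p (p ℕ.^ e)) (^-assocʳ y p (p ℕ.^ e)) ⟩
    x ^ (p ℕ.* p ℕ.^ e) + y ^ (p ℕ.* p ℕ.^ e)    ∎
    where open ≡-Reasoning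

  -- Multiplication by a permutes F; comparing the products of all nonzero
  -- elements (0 being replaced by 1) before and after yields a ^ (order - 1) ≡ 1.
  ^order : ∀ a → a ^ order ≡ a
  ^order a with a ≟ 0#
  ... | yes refl = zero-power order (Enum.to 0#)
    where
    zero-power : ∀ m → Fin m → 0# ^ m ≡ 0#
    zero-power (suc m) _ = zeroˡ _
  ... | no  a≢0  = begin
    a ^ order                            ≡⟨ Prod.sum-replicate order ⟨
    product {order} (λ _ → a)            ≡⟨ Prod.sum-cong-≗ {order} (λ i → split (Enum.from i)) ⟨
    product (λ i → h (Enum.from i) * h′ (Enum.from i))
      ≡⟨ Prod.∑-distrib-+ (h ∘ Enum.from) (h′ ∘ Enum.from) ⟩
    product (h ∘ Enum.from) * product (h′ ∘ Enum.from) ≡⟨ cong₂ _*_ ∏h≡1 ∏h′≡a ⟩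
    1# * a                               ≡⟨ *-identityˡ a ⟩
    a                                    ∎
    where
    open ≡-Reasoning
    onZero : Carrier → Carrier → Carrier → Carrier
    onZero x u v with x ≟ 0#
    ... | yes _ = u
    ... | no  _ = v
    -- `h` is a off 0 and 1 at 0, `h′` the reverse, so their product is constantly a. Over F the
    -- values of `h` multiply to a^(order - 1) and those of `h′` to a single a, which avoids a
    -- truncated exponent.
    g h h′ : Carrier → Carrier
    g x = onZero x 1# x
    h x = onZero x 1# a
    h′ x = onZero x a 1#
    split : ∀ x → h x * h′ x ≡ a
    split x with x ≟ 0#
    ... | yes _ = *-identityˡ a
    ... | no  _ = *-identityʳ a
    g≢0 : ∀ x → g x ≢ 0#
    g≢0 x with x ≟ 0#
    ... | yes _   = 0≢1 ∘ sym
    ... | no x≢0  = x≢0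
    g-scale : ∀ x → g (a * x) ≡ h x * g x
    g-scale x with x ≟ 0# | (a * x) ≟ 0#
    ... | yes _    | yes _   = sym (*-identityˡ 1#)
    ... | yes refl | no ax≢0 = contradiction (zeroʳ a) ax≢0
    ... | no x≢0   | yes eq  = contradiction (*≡0 a≢0 eq) x≢0
    ... | no _     | no _    = refl
    product≢0 : ∀ {m} (t : Fin m → Carrier) → (∀ i → t i ≢ 0#) → product t ≢ 0#
    product≢0 {zero}  t _  eq = 0≢1 (sym eq)
    product≢0 {suc m} t t≢0   = *-≢0 (t≢0 zero) (product≢0 (t ∘ suc) (t≢0 ∘ suc))
    ∏g = product (g ∘ Enum.from)
    ∏h≡1 : product (h ∘ Enum.from) ≡ 1#
    ∏h≡1 = *-cancelˡ (product≢0 (g ∘ Enum.from) (g≢0 ∘ Enum.from)) (begin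
      ∏g * product (h ∘ Enum.from)                  ≡⟨ *-comm _ _ ⟩
      product (h ∘ Enum.from) * ∏g                  ≡⟨ Prod.∑-distrib-+ (h ∘ Enum.from) (g ∘ Enum.from) ⟨
      product (λ i → h (Enum.from i) * g (Enum.from i))
        ≡⟨ Prod.sum-cong-≗ {order} (λ i → g-scale (Enum.from i)) ⟨
      product (λ i → g (a * Enum.from i))
        ≡⟨ Prod.sum-cong-≗ {order} (λ i → cong g (Enum.strictlyInverseʳ (a * Enum.from i))) ⟨
      product (λ i → g (Enum.from (Enum.to (a * Enum.from i))))
        ≡⟨ Prod.sum-permute (g ∘ Enum.from) (toPermutation (scaling a≢0)) ⟨
      ∏g                                            ≡⟨ *-identityʳ ∏g ⟨
      ∏g * 1#                                       ∎)
    ∏h′≡a : product (h′ ∘ Enum.from) ≡ a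
    ∏h′≡a = trans (sum-single *-commutativeMonoid (h′ ∘ Enum.from) (Enum.to 0#) off) on
      where
      on : h′ (Enum.from (Enum.to 0#)) ≡ a
      on with Enum.from (Enum.to 0#) ≟ 0#
      ... | yes _ = refl
      ... | no ≢0 = contradiction (Enum.strictlyInverseʳ 0#) ≢0
      off : ∀ i → i ≢ Enum.to 0# → h′ (Enum.from i) ≡ 1#
      off i i≢ with Enum.from i ≟ 0#
      ... | yes eq = contradiction (trans (sym (Enum.strictlyInverseˡ i)) (cong Enum.to eq)) i≢
      ... | no _   = refl

  module _ (τ : Carrier → Carrier) (τ-+ : ∀ x y → τ (x + y) ≡ τ x + τ y) where

    additive-0 : τ 0# ≡ 0#
    additive-0 = ∙-cancelˡ (τ 0#) _ _
        (trans (sym (τ-+ 0# 0#)) (trans (cong τ (+-identityˡ 0#)) (sym (+-identityʳ _))))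

    additive-neg : ∀ x → τ (- x) ≡ - τ x
    additive-neg x = inverseˡ-unique _ _
        (trans (sym (τ-+ _ _)) (trans (cong τ (-‿inverseˡ x)) additive-0))

    kernel? : Decidable λ x → τ x ≡ 0#
    kernel? x = τ x ≟ 0#

    -- The fibre through x₀ is the kernel translated by x₀.
    fibre≡kernel : ∀ x₀ → # (λ x → τ x ≟ τ x₀) ≡ # kernel?
    fibre≡kernel x₀ = trans (∑-permute (translation x₀) λ x → indicator (τ x ≟ τ x₀))
      (#-cong (λ x → τ (x + x₀) ≟ τ x₀) kernel?
        (λ {x} eq → ∙-cancelʳ (τ x₀) _ _ (trans (sym (τ-+ x x₀)) (trans eq (sym (+-identityˡ _)))))
        (λ {x} eq → trans (τ-+ x x₀) (trans (cong (_+ τ x₀) eq) (+-identityˡ _))))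

    fibre≤kernel : ∀ y → # (λ x → τ x ≟ y) ≤ # kernel?
    fibre≤kernel y with find (λ x → τ x ≟ y)
    ... | yes (x₀ , refl) = ℕ.≤-reflexive (fibre≡kernel x₀)
    ... | no none = subst (_≤ # kernel?) (sym (trans
            (∑-cong λ x → indicator-no (τ x ≟ y) λ eq → none (x , eq))
            (MonoidSum.sum-replicate-zero ℕ.+-0-commutativeMonoid order))) z≤n

    #-preimage≤ : ∀ {P : Pred Carrier 0ℓ} (P? : Decidable P) → # (P? ∘ τ) ≤ # P? ℕ.* # kernel?
    #-preimage≤ P? = begin
      # (P? ∘ τ)                                          ≡⟨ #-fibres P? τ ⟩
      ∑ (λ y → indicator (P? y) ℕ.* # λ x → τ x ≟ y)
        ≤⟨ ∑-mono (λ y → ℕ.*-monoʳ-≤ (indicator (P? y)) (fibre≤kernel y)) ⟩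
      ∑ (λ y → indicator (P? y) ℕ.* # kernel?)            ≡⟨ ∑-*ʳ (λ y → indicator (P? y)) (# kernel?) ⟩
      # P? ℕ.* # kernel?                                  ∎
      where open ℕ.≤-Reasoning

    image? : Decidable λ y → ∃[ x ] τ x ≡ y
    image? y = find λ x → τ x ≟ y

    -- The first isomorphism theorem as a count: the fibres over the image partition F, and each has
    -- the size of the kernel.
    #image*#kernel : # image? ℕ.* # kernel? ≡ order
    #image*#kernel = begin
      # image? ℕ.* # kernel?
        ≡⟨ ∑-*ʳ (λ y → indicator (image? y)) (# kernel?) ⟨
      ∑ (λ y → indicator (image? y) ℕ.* # kernel?)        ≡⟨ ∑-cong fibre ⟩
      ∑ (λ y → indicator (image? y) ℕ.* # λ x → τ x ≟ y)  ≡⟨ #-fibres image? τ ⟨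
      # (image? ∘ τ)                                      ≡⟨ #-all (image? ∘ τ) (λ x → x , refl) ⟩
      order                                               ∎
      where
      open ≡-Reasoning
      fibre : ∀ y → indicator (image? y) ℕ.* # kernel? ≡ indicator (image? y) ℕ.* # λ x → τ x ≟ y
      fibre y with image? y
      ... | yes (x₀ , refl) = cong (1 ℕ.*_) (sym (fibre≡kernel x₀))
      ... | no _            = refl

-- Skew polynomials: right division and bounds on the number of roots.

module SkewPolynomials {order} (F : FiniteField order)
    (σ : FiniteField.Carrier F → FiniteField.Carrier F) where
  open FieldProperties F

  Poly : ℕ → Set
  Poly = Vec Carrier

  zeros : ∀ {d} → Poly d
  zeros = replicate _ 0#

  -- (a₀ , a₁ , …) stands for Σ aᵢ σⁱ with σ a = σ(a) σ. Right division by
  -- σ - c gives Σ aᵢ σⁱ = quot (σ - c) + rem. For σ = id, rem c is evaluation at c.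
  rem : ∀ {d} → Carrier → Poly d → Carrier
  rem c []      = 0#
  rem c (a ∷ f) = a + rem (σ c) f * c

  quot : ∀ {d} → Carrier → Poly (suc d) → Poly d
  quot c (a ∷ [])        = []
  quot c (a ∷ f@(_ ∷ _)) = rem (σ c) f ∷ quot (σ c) f

  -- Guarantees that splitting off a factor from a nonzero polynomial leaves a nonzero quotient, as
  -- the induction on the number of roots requires.
  quot-rem-zero : ∀ {d} c (f : Poly (suc d)) → rem c f ≡ 0# → quot c f ≡ zeros → f ≡ zeros
  quot-rem-zero c (a ∷ []) r≡0 _ =
    cong (_∷ []) (trans (sym (trans (cong (a +_) (zeroˡ c)) (+-identityʳ a))) r≡0)
  quot-rem-zero c (a ∷ f@(_ ∷ _)) r≡0 q≡0 = cong₂ _∷_ a≡0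
    (quot-rem-zero (σ c) f (∷-injectiveˡ q≡0) (∷-injectiveʳ q≡0))
    where
    open ≡-Reasoning
    a≡0 : a ≡ 0#
    a≡0 = begin
      a                      ≡⟨ +-identityʳ a ⟨
      a + 0#                 ≡⟨ cong (a +_) (zeroˡ c) ⟨
      a + 0# * c             ≡⟨ cong (λ r → a + r * c) (∷-injectiveˡ q≡0) ⟨
      a + rem (σ c) f * c    ≡⟨ r≡0 ⟩
      0#                     ∎

  -- The divisor σ - c is monic, so the leading coefficient survives division.
  last-quot : ∀ {d} c (f : Poly (suc (suc d))) → last (quot c f) ≡ last f
  last-quot c (a ∷ b ∷ [])        = trans (cong (b +_) (zeroˡ _)) (+-identityʳ b)
  last-quot c (a ∷ b ∷ f@(_ ∷ _)) = last-quot (σ c) (b ∷ f)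

  -- Comparison of constant coefficients. When the remainder vanishes, a₀ is minus the constant
  -- coefficient of the quotient times c; this is where the powers of N(-1) come from.
  head-rem : ∀ {d} c (f : Poly (suc (suc d))) → head f + head (quot c f) * c ≡ rem c f
  head-rem c (a ∷ _ ∷ _) = refl

  apply : ∀ {d} → Poly d → Carrier → Carrier
  apply []      x = 0#
  apply (a ∷ f) x = a * x + apply f (σ x)

  module Roots
    (σ-+ : ∀ x y → σ (x + y) ≡ σ x + σ y)
    (σ-* : ∀ x y → σ (x * y) ≡ σ x * σ y)
    (σ-1 : σ 1# ≡ 1#) where

    apply-+ : ∀ {d} (f : Poly d) x y → apply f (x + y) ≡ apply f x + apply f y
    apply-+ []      x y = sym (+-identityˡ 0#)
    apply-+ (a ∷ f) x y = begin
      a * (x + y) + apply f (σ (x + y))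
        ≡⟨ cong (λ z → a * (x + y) + z) (trans (cong (apply f) (σ-+ x y)) (apply-+ f (σ x) (σ y))) ⟩
      a * (x + y) + (apply f (σ x) + apply f (σ y))
        ≡⟨ solve 5 (λ a x y u v →
             a :* (x :+ y) :+ (u :+ v) := (a :* x :+ u) :+ (a :* y :+ v)) refl a x y _ _ ⟩
      (a * x + apply f (σ x)) + (a * y + apply f (σ y)) ∎
      where open ≡-Reasoning

    -- Right division evaluated at x, with the quotient term at c * x moved to the left: no minus
    -- sign occurs, so a semiring solver can treat it.
    division : ∀ {d} c (f : Poly (suc d)) x →
               apply f x + apply (quot c f) (c * x) ≡ apply (quot c f) (σ x) + rem c f * x
    division c (a ∷ []) x =
      solve 3 (λ a c x → (a :* x :+ con 0) :+ con 0 := con 0 :+ (a :+ con 0 :* c) :* x) refl a c x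
    division c (a ∷ f@(_ ∷ _)) x = begin
      (a * x + apply f (σ x)) + (ρ * (c * x) + apply g (σ (c * x)))
        ≡⟨ cong (λ z → (a * x + apply f (σ x)) + (ρ * (c * x) + apply g z)) (σ-* c x) ⟩
      (a * x + apply f (σ x)) + (ρ * (c * x) + apply g (σ c * σ x))
        ≡⟨ solve 6 (λ a x u ρ c v →
             (a :* x :+ u) :+ (ρ :* (c :* x) :+ v) := (u :+ v) :+ (a :+ ρ :* c) :* x)
             refl a x (apply f (σ x)) ρ c (apply g (σ c * σ x)) ⟩
      (apply f (σ x) + apply g (σ c * σ x)) + (a + ρ * c) * x
        ≡⟨ cong (_+ (a + ρ * c) * x) (division (σ c) f (σ x)) ⟩
      (apply g (σ (σ x)) + ρ * σ x) + (a + ρ * c) * x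
        ≡⟨ cong (_+ (a + ρ * c) * x) (+-comm _ _) ⟩
      (ρ * σ x + apply g (σ (σ x))) + (a + ρ * c) * x ∎
      where
      open ≡-Reasoning
      ρ = rem (σ c) f
      g = quot (σ c) f

    root? : ∀ {d} (f : Poly d) → Decidable λ x → apply f x ≡ 0#
    root? f x = apply f x ≟ 0#

    fixed? : Decidable λ x → σ x ≡ x
    fixed? x = σ x ≟ x

    σ-0 : σ 0# ≡ 0#
    σ-0 = additive-0 σ σ-+

    σ-≢0 : ∀ {x} → x ≢ 0# → σ x ≢ 0#
    σ-≢0 x≢0 σx≡0 = 0≢1 (begin
      0#                     ≡⟨ zeroˡ _ ⟨
      0# * σ (x≢0 ⁻¹)        ≡⟨ cong (_* σ (x≢0 ⁻¹)) σx≡0 ⟨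
      σ _ * σ (x≢0 ⁻¹)       ≡⟨ σ-* _ _ ⟨
      σ (_ * x≢0 ⁻¹)         ≡⟨ cong σ (*-inverseʳ x≢0) ⟩
      σ 1#                   ≡⟨ σ-1 ⟩
      1#                     ∎)
      where open ≡-Reasoning

    nonzero-root? : ∀ {d} (f : Poly d) → Dec (∃[ u ] u ≢ 0# × apply f u ≡ 0#)
    nonzero-root? f = find λ u → ¬? (u ≟ 0#) ×-dec root? f u

    #roots-trivial : ∀ {d} (f : Poly d) → ¬ (∃[ u ] u ≢ 0# × apply f u ≡ 0#) → # (root? f) ≤ 1
    #roots-trivial f none = #-unique (root? f) λ {x} {y} fx fy → trans (only-0 x fx) (sym (only-0 y fy))
      where
      only-0 : ∀ x → apply f x ≡ 0# → x ≡ 0#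
      only-0 x fx with x ≟ 0#
      ... | yes x≡0 = x≡0
      ... | no  x≢0 = contradiction (x , x≢0 , fx) none

    1≤#fixed : 1 ≤ # fixed?
    1≤#fixed = 1≤# fixed? σ-0

    -- The root u makes σ - c with c = σ(u)/u, whose kernel is u Fix(σ), a right factor of f.
    module Root {d} (f : Poly (suc d)) {u} (u≢0 : u ≢ 0#) (fu≡0 : apply f u ≡ 0#) where

      c : Carrier
      c = σ u * u≢0 ⁻¹

      cu≡σu : c * u ≡ σ u
      cu≡σu = trans (*-assoc _ _ u) (trans (cong (σ u *_) (*-inverseˡ u≢0)) (*-identityʳ _))

      -- At x = u the two quotient terms in `division` coincide because c u = σ(u), which leaves
      -- `rem c f * u` equal to 0.
      rem≡0 : rem c f ≡ 0#
      rem≡0 = *≡0 u≢0 (trans (*-comm u _) (∙-cancelˡ (apply (quot c f) (σ u)) _ _ (begin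
        apply (quot c f) (σ u) + rem c f * u     ≡⟨ division c f u ⟨
        apply f u + apply (quot c f) (c * u)      ≡⟨ cong₂ _+_ fu≡0 (cong (apply (quot c f)) cu≡σu) ⟩
        0# + apply (quot c f) (σ u)              ≡⟨ +-comm _ _ ⟩
        apply (quot c f) (σ u) + 0#              ∎)))
        where open ≡-Reasoning

      τ : Carrier → Carrier
      τ x = σ x + - (c * x)

      τ-+ : ∀ x y → τ (x + y) ≡ τ x + τ y
      τ-+ x y = begin
        σ (x + y) + - (c * (x + y))              ≡⟨ cong₂ _+_ (σ-+ x y) (additive-neg′ x y) ⟩
        (σ x + σ y) + (- (c * x) + - (c * y))
          ≡⟨ solve 4 (λ a b c d → (a :+ b) :+ (c :+ d) := (a :+ c) :+ (b :+ d)) refl _ _ _ _ ⟩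
        τ x + τ y                                ∎
        where
        open ≡-Reasoning
        additive-neg′ : ∀ x y → - (c * (x + y)) ≡ - (c * x) + - (c * y)
        additive-neg′ x y = trans (-‿distribʳ-* c _)
            (trans (cong (c *_) (sym (⁻¹-∙-comm x y))) (trans (distribˡ c _ _)
          (cong₂ _+_ (sym (-‿distribʳ-* c x)) (sym (-‿distribʳ-* c y)))))

      -- With zero remainder f is its quotient composed with τ = σ - c, so the roots of f are the
      -- preimage under τ of the roots of the quotient.
      apply-quot : ∀ x → apply (quot c f) (τ x) ≡ apply f x
      apply-quot x = ∙-cancelʳ (apply (quot c f) (c * x)) _ _ (begin
        apply (quot c f) (τ x) + apply (quot c f) (c * x)   ≡⟨ apply-+ (quot c f) _ _ ⟨
        apply (quot c f) (τ x + c * x)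
          ≡⟨ cong (apply (quot c f))
               (trans (+-assoc _ _ _) (trans (cong (σ x +_) (-‿inverseˡ _)) (+-identityʳ _))) ⟩
        apply (quot c f) (σ x)                             ≡⟨ +-identityʳ _ ⟨
        apply (quot c f) (σ x) + 0#
          ≡⟨ cong (apply (quot c f) (σ x) +_) (trans (cong (_* x) rem≡0) (zeroˡ x)) ⟨
        apply (quot c f) (σ x) + rem c f * x               ≡⟨ division c f x ⟨
        apply f x + apply (quot c f) (c * x)                ∎)
        where open ≡-Reasoning

      -- After the substitution x ↦ u x, the equation τ(u x) = 0 reads σ(u) σ(x) = σ(u) x, that is,
      -- σ(x) = x.
      #kernel-τ : # (kernel? τ τ-+) ≡ # fixed?
      #kernel-τ = trans (∑-permute (scaling u≢0) λ x → indicator (kernel? τ τ-+ x))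
        (#-cong (kernel? τ τ-+ ∘ (u *_)) fixed?
          (λ {x} eq → *-cancelˡ (σ-≢0 u≢0) (begin
            σ u * σ x      ≡⟨ σ-* u x ⟨
            σ (u * x)      ≡⟨ x∙y⁻¹≈ε⇒x≈y _ _ eq ⟩
            c * (u * x)    ≡⟨ *-assoc c u x ⟨
            c * u * x      ≡⟨ cong (_* x) cu≡σu ⟩
            σ u * x        ∎))
          λ {x} eq → begin
            σ (u * x) + - (c * (u * x))
              ≡⟨ cong₂ (λ a b → a + - b) (trans (σ-* u x) (cong (σ u *_) eq))
                   (trans (sym (*-assoc c u x)) (cong (_* x) cu≡σu)) ⟩
            σ u * x + - (σ u * x)         ≡⟨ -‿inverseʳ _ ⟩
            0#                            ∎)
        where open ≡-Reasoning

      #roots≤ : # (root? f) ≤ # (root? (quot c f)) ℕ.* # fixed?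
      #roots≤ = begin
        # (root? f)
          ≡⟨ #-cong (root? f) (root? (quot c f) ∘ τ) (trans (apply-quot _))
               (trans (sym (apply-quot _))) ⟩
        # (root? (quot c f) ∘ τ)                              ≤⟨ #-preimage≤ τ τ-+ (root? (quot c f)) ⟩
        # (root? (quot c f)) ℕ.* # (kernel? τ τ-+)
          ≡⟨ cong (# (root? (quot c f)) ℕ.*_) #kernel-τ ⟩
        # (root? (quot c f)) ℕ.* # fixed?                     ∎
        where open ℕ.≤-Reasoning

    private
      trivial-bound : ∀ k {d} (f : Poly d) → ¬ (∃[ u ] u ≢ 0# × apply f u ≡ 0#) →
                      # fixed? ℕ.* # (root? f) ≤ # fixed? ℕ.^ suc k
      trivial-bound k f none = ℕ.*-monoʳ-≤ (# fixed?)
        (ℕ.≤-trans (#roots-trivial f none) (ℕ.m^n>0 (# fixed?) {{ℕ.>-nonZero 1≤#fixed}} k))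

      step-bound : ∀ d {r s} → # fixed? ℕ.* s ≤ # fixed? ℕ.^ d → r ≤ s ℕ.* # fixed? →
                   # fixed? ℕ.* r ≤ # fixed? ℕ.^ suc d
      step-bound d {r} {s} s-bound r-bound = begin
        # fixed? ℕ.* r                    ≤⟨ ℕ.*-monoʳ-≤ (# fixed?) r-bound ⟩
        # fixed? ℕ.* (s ℕ.* # fixed?)     ≡⟨ cong (# fixed? ℕ.*_) (ℕ.*-comm s _) ⟩
        # fixed? ℕ.* (# fixed? ℕ.* s)     ≤⟨ ℕ.*-monoʳ-≤ (# fixed?) s-bound ⟩
        # fixed? ℕ.^ suc d                ∎
        where open ℕ.≤-Reasoning

    -- A `Poly d` has degree below d, so the expected bound is the (d - 1)-th power of the size of
    -- the fixed field. The extra factor on the left avoids the decremented exponent.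
    #roots-bound : ∀ {d} (f : Poly d) → f ≢ zeros → # fixed? ℕ.* # (root? f) ≤ # fixed? ℕ.^ d
    #roots-bound {zero}  []  f≢0 = contradiction refl f≢0
    #roots-bound {suc d} f   f≢0 with nonzero-root? f
    ... | no none = trivial-bound d f none
    ... | yes (u , u≢0 , fu≡0) =
      step-bound d (#roots-bound (quot c f) (f≢0 ∘ quot-rem-zero c f rem≡0)) #roots≤
      where open Root f u≢0 fu≡0

    module Norm
      (N : Carrier → Carrier)
      (N-* : ∀ x y → N (x * y) ≡ N x * N y)
      (N-1 : N 1# ≡ 1#)
      (N-σ : ∀ x → N (σ x) ≡ N x) where

      N-≢0 : ∀ {x} → x ≢ 0# → N x ≢ 0#
      N-≢0 x≢0 Nx≡0 = 0≢1 (begin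
        0#                     ≡⟨ zeroˡ _ ⟨
        0# * N (x≢0 ⁻¹)        ≡⟨ cong (_* N (x≢0 ⁻¹)) Nx≡0 ⟨
        N _ * N (x≢0 ⁻¹)       ≡⟨ N-* _ _ ⟨
        N (_ * x≢0 ⁻¹)         ≡⟨ cong N (*-inverseʳ x≢0) ⟩
        N 1#                   ≡⟨ N-1 ⟩
        1#                     ∎)
        where open ≡-Reasoning

      -- Splitting off a root replaces a₀ by b with a₀ = - b c and N(c) = 1, and keeps the leading
      -- coefficient, so the hypothesis passes to the quotient with one factor N(-1) less. For k = 0
      -- it would say N(a) ≢ N(a), so the splitting cannot be complete; it stops at a polynomial
      -- whose only possible root is 0, which costs no factor.
      #roots-norm-bound : ∀ {k} (f : Poly (suc k)) → N (head f) ≢ N (- 1#) ^ k * N (last f) →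
                          # fixed? ℕ.* # (root? f) ≤ # fixed? ℕ.^ k
      #roots-norm-bound {zero}  (a ∷ []) norms≢ = contradiction (sym (*-identityˡ _)) norms≢
      #roots-norm-bound {suc k} f        norms≢ with nonzero-root? f
      ... | no none = trivial-bound k f none
      ... | yes (u , u≢0 , fu≡0) = step-bound k (#roots-norm-bound (quot c f) (norms≢ ∘ norms≡)) #roots≤
        where
        open Root f u≢0 fu≡0
        open ≡-Reasoning
        Nc≡1 : N c ≡ 1#
        Nc≡1 = *-cancelˡ (N-≢0 u≢0) (begin
          N u * N c     ≡⟨ *-comm _ _ ⟩
          N c * N u     ≡⟨ N-* c u ⟨
          N (c * u)     ≡⟨ cong N cu≡σu ⟩
          N (σ u)       ≡⟨ N-σ u ⟩
          N u           ≡⟨ *-identityʳ _ ⟨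
          N u * 1#      ∎)
        b : Carrier
        b = head (quot c f)
        head≡ : head f ≡ - 1# * (b * c)
        head≡ = trans (inverseˡ-unique _ _ (trans (head-rem c f) rem≡0)) (sym (-1*x≈-x _))
        norms≡ : N b ≡ N (- 1#) ^ k * N (last (quot c f)) → N (head f) ≡ N (- 1#) ^ suc k * N (last f)
        norms≡ eq = begin
          N (head f)                                      ≡⟨ cong N head≡ ⟩
          N (- 1# * (b * c))
            ≡⟨ trans (N-* _ _) (cong (N (- 1#) *_) (N-* b c)) ⟩
          N (- 1#) * (N b * N c)                          ≡⟨ cong (λ z → N (- 1#) * (N b * z)) Nc≡1 ⟩
          N (- 1#) * (N b * 1#)
            ≡⟨ cong (N (- 1#) *_) (trans (*-identityʳ _) eq) ⟩
          N (- 1#) * (N (- 1#) ^ k * N (last (quot c f))) ≡⟨ *-assoc _ _ _ ⟨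
          N (- 1#) ^ suc k * N (last (quot c f))
            ≡⟨ cong (λ z → N (- 1#) ^ suc k * N z) (last-quot c f) ⟩
          N (- 1#) ^ suc k * N (last f)                   ∎

-- Roots of ordinary polynomials, for the upper bound on the size of the subfield.

module PolynomialRoots {order} (F : FiniteField order) where
  open FieldProperties F
  open SkewPolynomials F id using (Poly; zeros; quot; quot-rem-zero) renaming (rem to evalAt)

  -- This is f(x) - f(u) = (x - u) g(x) with the negative terms moved across, as in `division`.
  factor : ∀ {d} u (f : Poly (suc d)) x →
           evalAt x f + u * evalAt x (quot u f) ≡ evalAt u f + x * evalAt x (quot u f)
  factor u (a ∷ []) x = solve 3 (λ a u x →
    (a :+ con 0 :* x) :+ u :* con 0 := (a :+ con 0 :* u) :+ x :* con 0) refl a u x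
  factor u (a ∷ f@(_ ∷ _)) x = begin
    (a + fx * x) + u * (ρ + gx * x)
      ≡⟨ solve 6 (λ a fx x u ρ gx →
           (a :+ fx :* x) :+ u :* (ρ :+ gx :* x) := (a :+ u :* ρ) :+ (fx :+ u :* gx) :* x)
           refl a fx x u ρ gx ⟩
    (a + u * ρ) + (fx + u * gx) * x
      ≡⟨ cong (λ z → (a + u * ρ) + z * x) (factor u f x) ⟩
    (a + u * ρ) + (ρ + x * gx) * x
      ≡⟨ solve 5 (λ a x u ρ gx →
           (a :+ u :* ρ) :+ (ρ :+ x :* gx) :* x := (a :+ ρ :* u) :+ x :* (ρ :+ gx :* x))
           refl a x u ρ gx ⟩
    (a + ρ * u) + x * (ρ + gx * x) ∎
    where
    open ≡-Reasoning
    fx = evalAt x f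
    gx = evalAt x (quot u f)
    ρ  = evalAt u f

  root? : ∀ {d} (f : Poly d) → Decidable λ x → evalAt x f ≡ 0#
  root? f x = evalAt x f ≟ 0#

  #roots< : ∀ {d} (f : Poly d) → f ≢ zeros → # (root? f) < d
  #roots< {zero}  []  f≢0 = contradiction refl f≢0
  #roots< {suc d} f   f≢0 with find (root? f)
  ... | no none = s≤s (ℕ.≤-trans (ℕ.≤-reflexive
          (trans (∑-cong λ x → indicator-no (root? f x) λ fx≡0 → none (x , fx≡0)) #-none)) z≤n)
    where
    #-none : ∑ (λ _ → 0) ≡ 0
    #-none = trans (∑-*ʳ (λ _ → 0) 0) (ℕ.*-zeroʳ (∑ λ _ → 0))
  ... | yes (u , fu≡0) = s≤s (begin
          # (root? f)                                        ≤⟨ ∑-mono split ⟩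
          ∑ (λ x → indicator (u ≟ x) ℕ.+ indicator (root? g x))
            ≡⟨ ∑-+ (λ x → indicator (u ≟ x)) (λ x → indicator (root? g x)) ⟩
          # (u ≟_) ℕ.+ # (root? g)                           ≡⟨ cong (ℕ._+ # (root? g)) (#-singleton u) ⟩
          suc (# (root? g))
            ≤⟨ #roots< g (f≢0 ∘ quot-rem-zero u f fu≡0) ⟩
          d                                                  ∎)
    where
    open ℕ.≤-Reasoning
    g = quot u f
    split : ∀ x → indicator (root? f x) ≤ indicator (u ≟ x) ℕ.+ indicator (root? g x)
    split x with root? f x
    ... | no _ = z≤n
    ... | yes fx≡0 with u ≟ x
    ...   | yes _  = s≤s z≤n
    ...   | no u≢x = ℕ.≤-reflexive (sym (indicator-yes (root? g x) gx≡0))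
      where
      gx≡0 : evalAt x g ≡ 0#
      gx≡0 with evalAt x g ≟ 0#
      ... | yes eq = eq
      -- With f(x) = f(u) = 0, `factor` reads u g(x) = x g(x), and cancelling g(x) would give u = x.
      ... | no gx≢0 = contradiction (*-cancelˡ gx≢0 (trans (*-comm _ u) (trans
              (∙-cancelˡ 0# _ _ (trans (cong (_+ u * evalAt x g) (sym fx≡0))
                (trans (factor u f x) (cong (_+ x * evalAt x g) fu≡0))))
              (*-comm x _)))) u≢x

  private
    X^ : ∀ j → Poly (suc j)
    X^ zero    = 1# ∷ []
    X^ (suc j) = 0# ∷ X^ j

    evalAt-X^ : ∀ j x → evalAt x (X^ j) ≡ x ^ j
    evalAt-X^ zero x = trans (cong (1# +_) (zeroˡ x)) (+-identityʳ 1#)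
    evalAt-X^ (suc j) x = trans (+-identityˡ _) (trans (cong (_* x) (evalAt-X^ j x)) (*-comm _ x))

  #power-fixed≤ : ∀ q → 1 < q → # (λ x → x ^ q ≟ x) ≤ q
  #power-fixed≤ (suc zero)    (s≤s ())
  #power-fixed≤ (suc (suc j)) _ = begin
    # (λ x → x ^ suc (suc j) ≟ x)  ≤⟨ #-mono (λ x → x ^ suc (suc j) ≟ x) (root? f) (λ {x} → isRoot x) ⟩
    # (root? f)
      ≤⟨ ℕ.≤-pred (#roots< f (λ f≡0 → -1≢0 (∷-injectiveˡ (∷-injectiveʳ f≡0)))) ⟩
    suc (suc j)                    ∎
    where
    open ℕ.≤-Reasoning
    f : Poly (suc (suc (suc j)))
    -- The polynomial X^q - X for q = j + 2. It is seen to be nonzero by its coefficient -1 in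
    -- degree 1, and its q + 1 coefficients allow at most q roots.
    f = 0# ∷ - 1# ∷ X^ j
    isRoot : ∀ x → x ^ suc (suc j) ≡ x → evalAt x f ≡ 0#
    isRoot x eq = trans (+-identityˡ _) (trans (*-comm _ x) (trans (distribˡ x _ _) (trans
      (cong₂ _+_ (trans (*-comm x _) (-1*x≈-x x)) (trans (cong (λ z → x * (z * x)) (evalAt-X^ j x))
        (trans (cong (x *_) (*-comm _ x)) eq)))
      (-‿inverseˡ x))))

-- Frobenius powers, the norm, and the subfield of order q.

primePower>1 : ∀ {q} → IsPrimePower q → 1 < q
primePower>1 (p , suc e , p-prime , _ , refl) =
  ℕ.≤-trans (ℕ.nonTrivial⇒n>1 p {{prime⇒nonTrivial p-prime}})
    (ℕ.m≤m*n p (p ℕ.^ e) {{ℕ.m^n≢0 p e {{prime⇒nonZero p-prime}}}})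

module Frobenius (q n : ℕ) .{{_ : NonZero n}} (primePower : IsPrimePower q)
    (F : FiniteField (q ℕ.^ n)) where
  open FieldProperties F public
  open LinearizedPolynomials q n F public
  open import Data.Integer.Base using (+_)
  open ℤSolver.+-*-Solver using () renaming
    (solve to ℤsolve; _:=_ to _ℤ:=_; _:+_ to _ℤ:+_; _:*_ to _ℤ:*_; _:-_ to _ℤ:-_)

  1<q : 1 < q
  1<q = primePower>1 primePower

  instance
    q-nonZero : NonZero q
    q-nonZero = ℕ.>-nonZero (ℕ.<-trans (s≤s z≤n) 1<q)

  φ : ℕ → Carrier → Carrier
  φ m x = x ^ (q ℕ.^ m)

  φ1≡^q : ∀ x → φ 1 x ≡ x ^ q
  φ1≡^q x = cong (x ^_) (ℕ.*-identityʳ q)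

  φ-+ : ∀ m x y → φ m (x + y) ≡ φ m x + φ m y
  φ-+ m x y = let (p , e , p-prime , _ , q≡pᵉ) = primePower in subst (λ r → (x + y) ^ r ≡ x ^ r + y ^ r)
    (trans (sym (ℕ.^-*-assoc p e m)) (cong (ℕ._^ m) (sym q≡pᵉ)))
    (^pᵉ-distrib-+ p-prime
      (prime-characteristic (e ℕ.* n) (trans (cong (ℕ._^ n) q≡pᵉ) (ℕ.^-*-assoc p e n)))
      (e ℕ.* m) x y)

  φ-* : ∀ m x y → φ m (x * y) ≡ φ m x * φ m y
  φ-* m x y = ^-distrib-* x y (q ℕ.^ m)

  φ-1 : ∀ m → φ m 1# ≡ 1#
  φ-1 m = 1^ (q ℕ.^ m)

  φ-0 : ∀ m → φ m 0# ≡ 0#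
  φ-0 m = additive-0 (φ m) (φ-+ m)

  φ-0th : ∀ x → φ 0 x ≡ x
  φ-0th = *-identityʳ

  φ-φ : ∀ l m x → φ l (φ m x) ≡ φ (l ℕ.+ m) x
  φ-φ l m x = trans (^-assocʳ x (q ℕ.^ m) (q ℕ.^ l))
    (cong (x ^_) (trans (ℕ.*-comm (q ℕ.^ m) _) (sym (ℕ.^-distribˡ-+-* q l m))))

  φ-n : ∀ x → φ n x ≡ x
  φ-n = ^order

  φ-fixed-* : ∀ {m x} → φ m x ≡ x → ∀ t → φ (t ℕ.* m) x ≡ x
  φ-fixed-* {x = x}     eq zero    = φ-0th x
  φ-fixed-* {m} {x} eq (suc t) = trans (sym (φ-φ m (t ℕ.* m) x)) (trans (cong (φ m) (φ-fixed-* eq t)) eq)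

  φ-+-*n : ∀ r t x → φ (r ℕ.+ t ℕ.* n) x ≡ φ r x
  φ-+-*n r t x = trans (sym (φ-φ r (t ℕ.* n) x)) (cong (φ r) (φ-fixed-* (φ-n x) t))

  -- Congruent exponents give the same map. The multiples of n are taken in ℤ because shifts may be
  -- negative; ordering t and u makes their difference a natural multiple of n, which φ ignores.
  φ-≡-mod : ∀ {l m} (t u : ℤ) → + l ℤ.+ t ℤ.* + n ≡ + m ℤ.+ u ℤ.* + n → ∀ x → φ l x ≡ φ m x
  φ-≡-mod {l} {m} t u eq x =
      [ (λ t≤u → ordered t u eq t≤u) , (λ u≤t → sym (ordered u t (sym eq) u≤t)) ]′ (ℤ.≤-total t u)
    where
    ordered : ∀ {l m} (t u : ℤ) → + l ℤ.+ t ℤ.* + n ≡ + m ℤ.+ u ℤ.* + n → t ℤ.≤ u → φ l x ≡ φ m x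
    ordered {l} {m} t u eq t≤u = trans (cong (λ k → φ k x) (ℤ.+-injective (begin
      + l
        ≡⟨ ℤsolve 3 (λ l t n → l ℤ:= (l ℤ:+ t ℤ:* n) ℤ:- t ℤ:* n) refl (+ l) t (+ n) ⟩
      (+ l ℤ.+ t ℤ.* + n) ℤ.- t ℤ.* + n                 ≡⟨ cong (ℤ._- t ℤ.* + n) eq ⟩
      (+ m ℤ.+ u ℤ.* + n) ℤ.- t ℤ.* + n
        ≡⟨ ℤsolve 4 (λ m u t n → (m ℤ:+ u ℤ:* n) ℤ:- t ℤ:* n ℤ:= m ℤ:+ (u ℤ:- t) ℤ:* n) refl
             (+ m) u t (+ n) ⟩
      + m ℤ.+ (u ℤ.- t) ℤ.* + n
        ≡⟨ cong (λ d → + m ℤ.+ d ℤ.* + n) (ℤ.0≤i⇒+∣i∣≡i (ℤ.i≤j⇒0≤j-i t≤u)) ⟨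
      + m ℤ.+ + d ℤ.* + n                               ≡⟨ cong (λ k → + m ℤ.+ k) (ℤ.pos-* d n) ⟨
      + m ℤ.+ + (d ℕ.* n)                               ≡⟨ ℤ.pos-+ m (d ℕ.* n) ⟨
      + (m ℕ.+ d ℕ.* n)                                 ∎))) (φ-+-*n m d x)
      where
      open ≡-Reasoning
      d = ∣ u ℤ.- t ∣

  -- Allows any representative of `j` modulo n in place of the canonical remainder.
  frob-φ : ∀ {m} j t → j ≡ + m ℤ.+ t ℤ.* + n → ∀ x → frob x j ≡ φ m x
  frob-φ j t eq = φ-≡-mod (j /ℕ n) t (trans (sym (a≡a%ℕn+[a/ℕn]*n j n)) eq)

  frob-+ : ∀ m x → frob x (+ m) ≡ φ m x
  frob-+ m = frob-φ (+ m) (+ 0)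
      (sym (trans (cong (λ k → + m ℤ.+ k) (ℤ.*-zeroˡ (+ n))) (ℤ.+-identityʳ (+ m))))

  private
    residue : ℤ → ℕ
    residue j = j %ℕ n

  frob-frob : ∀ i j x → frob x (i ℤ.+ j) ≡ frob (frob x i) j
  frob-frob i j x = trans (frob-φ (i ℤ.+ j) (i /ℕ n ℤ.+ j /ℕ n) (begin
    i ℤ.+ j
      ≡⟨ cong₂ ℤ._+_ (a≡a%ℕn+[a/ℕn]*n i n) (a≡a%ℕn+[a/ℕn]*n j n) ⟩
    (+ residue i ℤ.+ (i /ℕ n) ℤ.* + n) ℤ.+ (+ residue j ℤ.+ (j /ℕ n) ℤ.* + n)
      ≡⟨ ℤsolve 5 (λ a b c d n →
           (a ℤ:+ b ℤ:* n) ℤ:+ (c ℤ:+ d ℤ:* n) ℤ:= (c ℤ:+ a) ℤ:+ (b ℤ:+ d) ℤ:* n) refl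
           (+ residue i) (i /ℕ n) (+ residue j) (j /ℕ n) (+ n) ⟩
    (+ residue j ℤ.+ + residue i) ℤ.+ (i /ℕ n ℤ.+ j /ℕ n) ℤ.* + n
      ≡⟨ cong (ℤ._+ (i /ℕ n ℤ.+ j /ℕ n) ℤ.* + n) (ℤ.pos-+ (residue j) (residue i)) ⟨
    + (residue j ℕ.+ residue i) ℤ.+ (i /ℕ n ℤ.+ j /ℕ n) ℤ.* + n ∎) x)
    (sym (φ-φ (residue j) (residue i) x))
    where
    open ≡-Reasoning

  frob-* : ∀ s m x → frob x (s ℤ.* + m) ≡ φ (m ℕ.* residue s) x
  frob-* s m = frob-φ (s ℤ.* + m) ((s /ℕ n) ℤ.* + m) (begin
    s ℤ.* + m
      ≡⟨ cong (ℤ._* + m) (a≡a%ℕn+[a/ℕn]*n s n) ⟩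
    (+ residue s ℤ.+ (s /ℕ n) ℤ.* + n) ℤ.* + m
      ≡⟨ ℤsolve 4 (λ r t n m → (r ℤ:+ t ℤ:* n) ℤ:* m ℤ:= (m ℤ:* r) ℤ:+ (t ℤ:* m) ℤ:* n) refl
           (+ residue s) (s /ℕ n) (+ n) (+ m) ⟩
    (+ m ℤ.* + residue s) ℤ.+ ((s /ℕ n) ℤ.* + m) ℤ.* + n
      ≡⟨ cong (ℤ._+ ((s /ℕ n) ℤ.* + m) ℤ.* + n) (ℤ.pos-* m (residue s)) ⟨
    + (m ℕ.* residue s) ℤ.+ ((s /ℕ n) ℤ.* + m) ℤ.* + n ∎)
    where
    open ≡-Reasoning

  -- An element fixed by φ r and by φ n is fixed by φ 1, since Bézout writes 1 as a difference of
  -- multiples of r and n. The remainder r of s is still coprime to n.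
  frob-fixed⇒∈𝔽q : ∀ s → ℤ.gcd s (+ n) ≡ + 1 → ∀ {x} → φ (residue s) x ≡ x → x ^ q ≡ x
  frob-fixed⇒∈𝔽q s coprime {x} fixed = trans (sym (φ1≡^q x)) (fix (ℕ.Bézout.identity (ℕ.gcd-GCD r n)))
    where
    r = residue s
    gcd∣s : ℕ.gcd r n ∣ ∣ s ∣
    gcd∣s = ℤ.∣⇒∣ᵤ {+ ℕ.gcd r n} {s} (subst (+ ℕ.gcd r n ℤ.∣_) (sym (a≡a%ℕn+[a/ℕn]*n s n))
      (ℤ.∣m∣n⇒∣m+n (ℤ.∣ᵤ⇒∣ {+ ℕ.gcd r n} {+ r} (ℕ.gcd[m,n]∣m r n))
        (ℤ.∣n⇒∣m*n (s /ℕ n) (ℤ.∣ᵤ⇒∣ {+ ℕ.gcd r n} {+ n} (ℕ.gcd[m,n]∣n r n)))))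
    gcd≡1 : ℕ.gcd r n ≡ 1
    gcd≡1 = ℕ.∣1⇒≡1 (subst (ℕ.gcd r n ∣_) (ℤ.+-injective coprime)
        (ℕ.gcd-greatest gcd∣s (ℕ.gcd[m,n]∣n r n)))
    fix : ℕ.Bézout.Identity (ℕ.gcd r n) r n → φ 1 x ≡ x
    fix id rewrite gcd≡1 with id
    ... | ℕ.Bézout.+- a b eq =
        trans (sym (φ-+-*n 1 b x)) (trans (cong (λ k → φ k x) eq) (φ-fixed-* fixed a))
    ... | ℕ.Bézout.-+ a b eq = begin
      φ 1 x                   ≡⟨ cong (φ 1) (φ-fixed-* fixed a) ⟨
      φ 1 (φ (a ℕ.* r) x)     ≡⟨ φ-φ 1 (a ℕ.* r) x ⟩
      φ (1 ℕ.+ a ℕ.* r) x     ≡⟨ cong (λ k → φ k x) eq ⟩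
      φ (b ℕ.* n) x           ≡⟨ φ-fixed-* (φ-n x) b ⟩
      x                       ∎
      where open ≡-Reasoning

  ∈𝔽q⇒φ-fixed : ∀ {x} → x ^ q ≡ x → ∀ m → φ m x ≡ x
  ∈𝔽q⇒φ-fixed {x} eq m =
      trans (cong (λ k → φ k x) (sym (ℕ.*-identityʳ m))) (φ-fixed-* (trans (φ1≡^q x) eq) m)

  norm-* : ∀ x y → norm (x * y) ≡ norm x * norm y
  norm-* x y = trans (Prod.sum-cong-≗ {n} (λ i → φ-* (toℕ i) x y))
    (Prod.∑-distrib-+ {n} (λ i → φ (toℕ i) x) (λ i → φ (toℕ i) y))

  norm-1 : norm 1# ≡ 1#
  norm-1 = trans (Prod.sum-cong-≗ {n} (λ i → φ-1 (toℕ i))) (Prod.sum-replicate-zero n)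

  -- The conjugates are shifted cyclically: the last factor is φ n x = x and returns to the front.
  -- `rotate` takes an arbitrary m so that the product can be split at its last factor.
  norm-^q : ∀ x → norm (φ 1 x) ≡ norm x
  norm-^q x = rotate n (φ-n x)
    where
    open ≡-Reasoning
    rotate : ∀ m → φ m x ≡ x →
        product (λ (i : Fin m) → φ (toℕ i) (φ 1 x)) ≡ product (λ (i : Fin m) → φ (toℕ i) x)
    rotate zero    _  = refl
    rotate (suc m) eq = begin
      product (λ (i : Fin (suc m)) → φ (toℕ i) (φ 1 x))
        ≡⟨ Prod.sum-init-last (λ (i : Fin (suc m)) → φ (toℕ i) (φ 1 x)) ⟩
      product (λ (i : Fin m) → φ (toℕ (inject₁ i)) (φ 1 x)) * φ (toℕ (Fin.fromℕ m)) (φ 1 x)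
        ≡⟨ cong₂ _*_ (Prod.sum-cong-≗ {m} λ i →
             trans (cong (λ k → φ k (φ 1 x)) (Fin.toℕ-inject₁ i)) (shift (toℕ i)))
                     (trans (cong (λ k → φ k (φ 1 x)) (Fin.toℕ-fromℕ m))
                         (trans (shift m) (trans eq (sym (φ-0th x))))) ⟩
      product (λ (i : Fin m) → φ (suc (toℕ i)) x) * φ 0 x
        ≡⟨ *-comm _ _ ⟩
      φ 0 x * product (λ (i : Fin m) → φ (suc (toℕ i)) x) ∎
      where
      shift : ∀ k → φ k (φ 1 x) ≡ φ (suc k) x
      shift k = trans (φ-φ k 1 x) (cong (λ l → φ l x) (ℕ.+-comm k 1))

  norm-φ : ∀ m x → norm (φ m x) ≡ norm x
  norm-φ zero    x = cong norm (φ-0th x)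
  norm-φ (suc m) x = trans (cong norm (sym (φ-φ 1 m x))) (trans (norm-^q (φ m x)) (norm-φ m x))

  norm-neg-1 : norm (- 1#) ≡ (- 1#) ^ n
  norm-neg-1 = trans
    (Prod.sum-cong-≗ {n} (λ i →
        trans (additive-neg (φ (toℕ i)) (φ-+ (toℕ i)) 1#) (cong -_ (φ-1 (toℕ i)))))
    (Prod.sum-replicate n)

  𝔽q? : Decidable 𝔽q
  𝔽q? x = x ^ q ≟ x

  module Skew r = SkewPolynomials F (φ r)
  module SkewRoots r = Skew.Roots r (φ-+ r) (φ-* r) (φ-1 r)

  -- For the lower bound, σⁿ - 1 with σ = `φ 1` vanishes on F. If c is the number of fixed elements,
  -- the root bound gives c qⁿ ≤ c^(n+1), hence qⁿ ≤ cⁿ, which excludes c < q.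
  #𝔽q : # 𝔽q? ≡ q
  #𝔽q = ℕ.≤-antisym (PolynomialRoots.#power-fixed≤ F q 1<q) (ℕ.≮⇒≥ λ c<q →
    ℕ.<⇒≱ (ℕ.^-monoˡ-< n c<q) (ℕ.*-cancelˡ-≤ c {{ℕ.>-nonZero 1≤c}} (main n φ-n)))
    where
    open Skew 1
    open SkewRoots 1
    c = # 𝔽q?
    #fixed≡c : # fixed? ≡ c
    #fixed≡c = #-cong fixed? 𝔽q? (λ {x} → trans (sym (φ1≡^q x))) (λ {x} → trans (φ1≡^q x))
    1≤c : 1 ≤ c
    1≤c = subst (1 ≤_) #fixed≡c 1≤#fixed
    φ^ : ∀ m → Poly (suc m)
    φ^ zero    = 1# ∷ []
    φ^ (suc m) = 0# ∷ φ^ m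
    apply-φ^ : ∀ m x → apply (φ^ m) x ≡ φ m x
    apply-φ^ zero    x = trans (+-identityʳ _) (trans (*-identityˡ x) (sym (φ-0th x)))
    apply-φ^ (suc m) x = begin
      0# * x + apply (φ^ m) (φ 1 x)
        ≡⟨ trans (cong (_+ apply (φ^ m) (φ 1 x)) (zeroˡ x)) (+-identityˡ _) ⟩
      apply (φ^ m) (φ 1 x)           ≡⟨ apply-φ^ m (φ 1 x) ⟩
      φ m (φ 1 x)                   ≡⟨ φ-φ m 1 x ⟩
      φ (m ℕ.+ 1) x                 ≡⟨ cong (λ l → φ l x) (ℕ.+-comm m 1) ⟩
      φ (suc m) x                   ∎
      where open ≡-Reasoning
    main : ∀ m → .{{NonZero m}} → (∀ x → φ m x ≡ x) → c ℕ.* q ℕ.^ n ≤ c ℕ.* c ℕ.^ m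
    main (suc m) φ-m = begin
      c ℕ.* q ℕ.^ n            ≡⟨ cong₂ ℕ._*_ #fixed≡c (#-all (root? f) isRoot) ⟨
      # fixed? ℕ.* # (root? f) ≤⟨ #roots-bound f (λ f≡0 → -1≢0 (∷-injectiveˡ f≡0)) ⟩
      # fixed? ℕ.^ suc (suc m) ≡⟨ cong (ℕ._^ suc (suc m)) #fixed≡c ⟩
      c ℕ.* c ℕ.^ suc m        ∎
      where
      open ℕ.≤-Reasoning
      f = - 1# ∷ φ^ m
      isRoot : ∀ x → apply f x ≡ 0#
      isRoot x = trans (cong₂ _+_ (-1*x≈-x x) (trans (apply-φ^ m (φ 1 x))
        (trans (φ-φ m 1 x) (trans (cong (λ l → φ l x) (ℕ.+-comm m 1)) (φ-m x))))) (-‿inverseˡ x)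

  #fixed : ∀ r → (∀ {x} → φ r x ≡ x → x ∈ 𝔽q) → # (SkewRoots.fixed? r) ≡ q
  #fixed r fixed⇒∈𝔽q = trans
      (#-cong (SkewRoots.fixed? r) 𝔽q? fixed⇒∈𝔽q (λ x∈𝔽q → ∈𝔽q⇒φ-fixed x∈𝔽q r)) #𝔽q

-- Enumeration of spans by their coefficient vectors.

funToFin-cong : ∀ {m n} {f g : Fin m → Fin n} → f ≗ g → funToFin f ≡ funToFin g
funToFin-cong {zero}  _   = refl
funToFin-cong {suc m} f≗g = cong₂ combine (f≗g zero) (funToFin-cong (f≗g ∘ suc))

finToFun-injective : ∀ {m n} {i j : Fin (n ℕ.^ m)} → finToFun {n} {m} i ≗ finToFun j → i ≡ j
finToFun-injective {m} {n} {i} {j} eq =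
  trans (sym (Fin.funToFin-finToFin {m} {n} i))
      (trans (funToFin-cong eq) (Fin.funToFin-finToFin {m} {n} j))

module SpanEnumeration {order} (F : FiniteField order)
    (V : RawLeftModule (FiniteField.Carrier F) 0ℓ 0ℓ) where
  open FiniteField F using (Carrier; _+_; -_; 0#)
  open RawLeftModule V
  open LinearAlgebra F V

  sumᴹ-cong : ∀ {m} {u v : Vector Carrierᴹ m} → u ≗ v → sumᴹ u ≡ sumᴹ v
  sumᴹ-cong {zero}  _   = refl
  sumᴹ-cong {suc m} u≗v = cong₂ _+ᴹ_ (u≗v zero) (sumᴹ-cong (u≗v ∘ suc))

  combination-cong : ∀ {m} {c d : Vector Carrier m} v → c ≗ d → combination c v ≡ combination d v
  combination-cong v c≗d = sumᴹ-cong λ i → cong (_*ₗ v i) (c≗d i)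

  module Elements {K : Pred Carrier 0ℓ} {m} (e : Fin m → Carrier)
    (e-injective : Injective _≡_ _≡_ e) (e∈K : ∀ i → e i ∈ K)
        (e-complete : ∀ {a} → a ∈ K → ∃ λ i → e i ≡ a)
    {r} (b : Vector Carrierᴹ r) where

    element : Fin (m ℕ.^ r) → Carrierᴹ
    element i = combination (e ∘ finToFun i) b

    element-complete : ∀ {w} → w ∈ Span K b → ∃ λ i → element i ≈ᴹ w
    element-complete (c , c∈K , eq) = i , subst (_≈ᴹ _) (combination-cong b pointwise) eq
      where
      code = λ k → proj₁ (e-complete (c∈K k))
      i    = funToFin code
      pointwise : ∀ k → c k ≡ e (finToFun i k)
      pointwise k = trans (sym (proj₂ (e-complete (c∈K k))))
          (cong e (sym (Fin.finToFun-funToFin code k)))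

    element∈Span : ∀ {i w} → element i ≈ᴹ w → w ∈ Span K b
    element∈Span {i} eq = e ∘ finToFun i , (λ k → e∈K (finToFun i k)) , eq

    -- A raw module carries no laws, so the closure of K under differences and the behaviour of
    -- combinations under differences enter as arguments. This serves both 𝔽q acting on F and F
    -- acting on `Lin`.
    element-injective :
      (∀ {x y} → x ∈ K → y ∈ K → x + - y ∈ K) → (∀ {x y} → x + - y ≡ 0# → x ≡ y) →
      (∀ (c d : Vector Carrier r) → combination c b ≈ᴹ combination d b →
          combination (λ i → c i + - d i) b ≈ᴹ 0ᴹ) →
      LinearlyIndependent K b → ∀ {i j} → element i ≈ᴹ element j → i ≡ j
    element-injective K-- cancel difference independent {i} {j} eq = finToFun-injective λ k →
      e-injective (cancel (independent _ (λ k → K-- (e∈K _) (e∈K _)) (difference _ _ eq) k))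

-- Bases over the subfield, evaluation of linearized polynomials, rank and nullity.

module RankNullity (q n : ℕ) .{{_ : NonZero n}} (primePower : IsPrimePower q)
    (F : FiniteField (q ℕ.^ n)) where
  open Frobenius q n primePower F public

  𝔽q-+ : ∀ {x y} → x ∈ 𝔽q → y ∈ 𝔽q → x + y ∈ 𝔽q
  𝔽q-+ {x} {y} xK yK = trans (sym (φ1≡^q _))
      (trans (φ-+ 1 x y) (cong₂ _+_ (trans (φ1≡^q x) xK) (trans (φ1≡^q y) yK)))

  𝔽q-* : ∀ {x y} → x ∈ 𝔽q → y ∈ 𝔽q → x * y ∈ 𝔽q
  𝔽q-* {x} {y} xK yK = trans (^-distrib-* x y q) (cong₂ _*_ xK yK)

  𝔽q-neg : ∀ {x} → x ∈ 𝔽q → - x ∈ 𝔽q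
  𝔽q-neg {x} xK = trans (sym (φ1≡^q _))
      (trans (additive-neg (φ 1) (φ-+ 1) x) (cong -_ (trans (φ1≡^q x) xK)))

  𝔽q-⁻¹ : ∀ {x} (x≢0 : x ≢ 0#) → x ∈ 𝔽q → x≢0 ⁻¹ ∈ 𝔽q
  𝔽q-⁻¹ {x} x≢0 xK = *-cancelˡ x≢0 (begin
    x * x≢0 ⁻¹ ^ q        ≡⟨ cong (_* x≢0 ⁻¹ ^ q) xK ⟨
    x ^ q * x≢0 ⁻¹ ^ q    ≡⟨ ^-distrib-* x (x≢0 ⁻¹) q ⟨
    (x * x≢0 ⁻¹) ^ q      ≡⟨ cong (_^ q) (*-inverseʳ x≢0) ⟩
    1# ^ q                ≡⟨ 1^ q ⟩
    1#                    ≡⟨ *-inverseʳ x≢0 ⟨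
    x * x≢0 ⁻¹            ∎)
    where open ≡-Reasoning

  private
    𝔽q-enumeration : ∃ λ (e : Fin q → Carrier) →
      Injective _≡_ _≡_ e × (∀ j → e j ∈ 𝔽q) × (∀ {x} → x ∈ 𝔽q → ∃ λ j → e j ≡ x)
    𝔽q-enumeration = subst
      (λ m → ∃ λ (e : Fin m → Carrier) →
          Injective _≡_ _≡_ e × (∀ j → e j ∈ 𝔽q) × (∀ {x} → x ∈ 𝔽q → ∃ λ j → e j ≡ x))
      #𝔽q (#-enumerate 𝔽q?)

  module FSpan = SpanEnumeration F (tensorUnit {R = rawRing})
  module 𝔽qSpan {r} (b : Vector Carrier r) =
      FSpan.Elements {𝔽q} (proj₁ 𝔽q-enumeration) (proj₁ (proj₂ 𝔽q-enumeration))
    (proj₁ (proj₂ (proj₂ 𝔽q-enumeration))) (proj₂ (proj₂ (proj₂ 𝔽q-enumeration))) b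

  x-y≡0⇒x≡y : ∀ {x y} → x + - y ≡ 0# → x ≡ y
  x-y≡0⇒x≡y {x} {y} = x∙y⁻¹≈ε⇒x≈y x y

  combination-difference : ∀ {r} (c d b : Vector Carrier r) →
    OverF.combination (λ i → c i + - d i) b ≡ OverF.combination c b + - OverF.combination d b
  combination-difference c d b = begin
    sum (λ i → (c i + - d i) * b i)
      ≡⟨ sum-cong-≗ (λ i → trans (distribʳ (b i) (c i) (- d i))
           (cong (c i * b i +_) (sym (-‿distribˡ-* (d i) (b i))))) ⟩
    sum (λ i → c i * b i + - (d i * b i))     ≡⟨ ∑-distrib-+ (λ i → c i * b i) (λ i → - (d i * b i)) ⟩
    sum (λ i → c i * b i) + sum (λ i → - (d i * b i))
      ≡⟨ cong (sum (λ i → c i * b i) +_) (sum-neg (λ i → d i * b i)) ⟩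
    sum (λ i → c i * b i) + - sum (λ i → d i * b i)   ∎
    where
    open ≡-Reasoning
    sum-neg : ∀ {m} (t : Vector Carrier m) → sum (λ i → - t i) ≡ - sum t
    sum-neg {zero}  t = sym ε⁻¹≈ε
    sum-neg {suc m} t = trans (cong (λ s → - t zero + s) (sum-neg (t ∘ suc))) (⁻¹-∙-comm _ _)

  𝔽q-element-injective : ∀ {r} (b : Vector Carrier r) → OverF.LinearlyIndependent 𝔽q b →
                      ∀ {i j} → 𝔽qSpan.element b i ≡ 𝔽qSpan.element b j → i ≡ j
  𝔽q-element-injective b independent {i} {j} = 𝔽qSpan.element-injective b
    (λ xK yK → 𝔽q-+ xK (𝔽q-neg yK)) x-y≡0⇒x≡y
    (λ c d eq → trans (combination-difference c d b)
        (trans (cong (_+ - OverF.combination d b) eq) (-‿inverseʳ _)))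
    independent {i} {j}

  -- The bridge from dimensions to counts: with it, rank-nullity becomes an equation between powers
  -- of q and a kernel size.
  dimension⇒# : ∀ {W} (W? : Decidable W) {r} → OverF.HasDimension 𝔽q W r → # W? ≡ q ℕ.^ r
  dimension⇒# W? (b , independent , W⊆ , ⊆W) = ℕ.≤-antisym
    (cover⇒#≤ W? element (λ w → element-complete (W⊆ w)))
    (injection⇒≤# W? element (λ {i} {j} → 𝔽q-element-injective b independent {i} {j})
        (λ i → ⊆W (element∈Span {i} refl)))
    where open 𝔽qSpan b

  Span? : ∀ {r} (b : Vector Carrier r) → Decidable (OverF.Span 𝔽q b)
  Span? b w = map′ (λ (i , eq) → element∈Span {i} eq) element-complete (Fin.any? λ i → element i ≟ w)
    where open 𝔽qSpan b

  independent-∷ : ∀ {r} {b : Vector Carrier r} {w} → OverF.LinearlyIndependent 𝔽q b →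
                  ¬ w ∈ OverF.Span 𝔽q b → OverF.LinearlyIndependent 𝔽q (w Vector.∷ b)
  independent-∷ {r} {b} {w} independent w∉ c c∈K eq = λ where
      zero    → c₀≡0
      (suc i) → independent (c ∘ suc) (c∈K ∘ suc)
        (trans (sym (+-identityˡ _))
            (trans (cong (_+ OverF.combination (c ∘ suc) b)
                (sym (trans (cong (_* w) c₀≡0) (zeroˡ w)))) eq)) i
    where
    open ≡-Reasoning
    c₀≡0 : c zero ≡ 0#
    c₀≡0 with c zero ≟ 0#
    ... | yes c₀≡0 = c₀≡0
    ... | no  c₀≢0 = contradiction
      ( (λ i → - (c₀≢0 ⁻¹) * c (suc i))
      , (λ i → 𝔽q-* (𝔽q-neg (𝔽q-⁻¹ c₀≢0 (c∈K zero))) (c∈K (suc i)))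
      , (begin
          sum (λ i → - (c₀≢0 ⁻¹) * c (suc i) * b i)
            ≡⟨ sum-cong-≗ (λ i → *-assoc (- (c₀≢0 ⁻¹)) (c (suc i)) (b i)) ⟩
          sum (λ i → - (c₀≢0 ⁻¹) * (c (suc i) * b i))
            ≡⟨ *-distribˡ-sum (- (c₀≢0 ⁻¹)) (λ i → c (suc i) * b i) ⟨
          - (c₀≢0 ⁻¹) * sum (λ i → c (suc i) * b i)
            ≡⟨ cong (- (c₀≢0 ⁻¹) *_) (inverseʳ-unique _ _ eq) ⟩
          - (c₀≢0 ⁻¹) * - (c zero * w)                  ≡⟨ -‿distribˡ-* _ _ ⟨
          - (c₀≢0 ⁻¹ * - (c zero * w))                  ≡⟨ cong -_ (sym (-‿distribʳ-* _ _)) ⟩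
          - - (c₀≢0 ⁻¹ * (c zero * w))                  ≡⟨ ⁻¹-involutive _ ⟩
          c₀≢0 ⁻¹ * (c zero * w)                        ≡⟨ *-assoc _ _ _ ⟨
          c₀≢0 ⁻¹ * c zero * w                          ≡⟨ cong (_* w) (*-inverseˡ c₀≢0) ⟩
          1# * w                                        ≡⟨ *-identityˡ w ⟩
          w                                             ∎)) w∉

  independent⇒≤n : ∀ {r} (b : Vector Carrier r) → OverF.LinearlyIndependent 𝔽q b → r ≤ n
  independent⇒≤n {r} b independent = ℕ.≮⇒≥ λ n<r → ℕ.<⇒≱ (ℕ.^-monoʳ-< q 1<q n<r)
    (subst (q ℕ.^ r ≤_) (#-all (λ (_ : Carrier) → yes refl) (λ _ → refl {x = 0#}))
      (injection⇒≤# (λ _ → yes refl) (𝔽qSpan.element b)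
          (λ {i} {j} → 𝔽q-element-injective b independent {i} {j}) (λ _ → refl {x = 0#})))

  -- Greedy extension: while search finds an element of W outside the span, it is adjoined. The fuel
  -- `suc n` cannot run out, because independent families have at most n members.
  basis : ∀ {W} → Decidable W → OverF.IsSubspace 𝔽q W → ∃ λ r → OverF.HasDimension 𝔽q W r
  basis {W} W? (0∈W , W-+ , W-*) = extend (suc n) {0} (λ ()) (λ _ _ _ ()) (λ ()) ℕ.≤-refl
    where
    span⊆W : ∀ {r} {b : Vector Carrier r} → (∀ i → b i ∈ W) → ∀ {w} → w ∈ OverF.Span 𝔽q b → w ∈ W
    span⊆W {b = b} b∈W (c , c∈K , refl) = closed _ (λ i → W-* (c∈K i) (b∈W i))
      where
      closed : ∀ {r} (t : Vector Carrier r) → (∀ i → t i ∈ W) → sum t ∈ W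
      closed {zero}  t _   = 0∈W
      closed {suc r} t t∈W = W-+ (t∈W zero) (closed (t ∘ suc) (t∈W ∘ suc))
    extend : ∀ fuel {r} (b : Vector Carrier r) → OverF.LinearlyIndependent 𝔽q b → (∀ i → b i ∈ W) →
             n < r ℕ.+ fuel → ∃ λ r → OverF.HasDimension 𝔽q W r
    extend zero {r} b independent _ n<r =
      contradiction (independent⇒≤n b independent) (ℕ.<⇒≱ (subst (n <_) (ℕ.+-identityʳ r) n<r))
    extend (suc fuel) {r} b independent b∈W n<r+fuel with find (λ w → W? w ×-dec ¬? (Span? b w))
    ... | yes (w , w∈W , w∉) = extend fuel (w Vector.∷ b) (independent-∷ independent w∉)
            (λ where zero → w∈W ; (suc i) → b∈W i) (subst (n <_) (ℕ.+-suc r fuel) n<r+fuel)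
    ... | no none = r , b , independent ,
            (λ {w} w∈W → decidable-stable (Span? b w) (λ w∉ → none (w , w∈W , w∉))) , span⊆W b∈W

  𝔽q-basis : ∃ λ (b : Vector Carrier n) → OverF.LinearlyIndependent 𝔽q b
  -- A trivially true predicate stands for all of F; comparing q^r with qⁿ then forces r = n.
  𝔽q-basis with basis {λ _ → 0# ≡ 0#} (λ _ → yes refl) (refl , (λ _ _ → refl) , (λ _ _ → refl))
  ... | r , dim@(b , independent , _) =
      subst (λ r → ∃ λ (b : Vector Carrier r) → OverF.LinearlyIndependent 𝔽q b)
    (ℕ.≤-antisym (independent⇒≤n b independent) (ℕ.≮⇒≥ λ r<n → ℕ.<⇒≢ (ℕ.^-monoʳ-< q 1<q r<n)
      (trans (sym (dimension⇒# (λ _ → yes refl) dim))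
          (#-all (λ _ → yes refl) (λ _ → refl {x = 0#}))))) (b , independent)

  -- A `Lin` is literally a skew polynomial with n coefficients for σ = `φ 1`, so the root bounds
  -- apply to it.
  eval≡apply : ∀ f x → eval f x ≡ Skew.apply 1 f x
  eval≡apply f x = general f x
    where
    general : ∀ {m} (f : Vec Carrier m) x → sum (λ i → lookup f i * φ (toℕ i) x) ≡ Skew.apply 1 f x
    general []      x = refl
    general {suc m} (a ∷ f) x = cong₂ _+_ (cong (a *_) (φ-0th x)) (trans
      (sum-cong-≗ {m} λ i → cong (lookup f i *_)
        (sym (trans (φ-φ (toℕ i) 1 x) (cong (λ l → φ l x) (ℕ.+-comm (toℕ i) 1)))))
      (general f (φ 1 x)))

  eval-+ : ∀ f x y → eval f (x + y) ≡ eval f x + eval f y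
  eval-+ f x y = trans (eval≡apply f (x + y)) (trans (SkewRoots.apply-+ 1 f x y)
    (sym (cong₂ _+_ (eval≡apply f x) (eval≡apply f y))))

  eval-* : ∀ f {a} → a ∈ 𝔽q → ∀ x → eval f (a * x) ≡ a * eval f x
  eval-* f {a} aK x = trans (sum-cong-≗ {n} λ i → trans
      (cong (lookup f i *_) (trans (φ-* (toℕ i) a x) (cong (_* φ (toℕ i) x) (∈𝔽q⇒φ-fixed aK (toℕ i)))))
      (solve 3 (λ c a y → c :* (a :* y) := a :* (c :* y)) refl (lookup f i) a (φ (toℕ i) x)))
    (sym (*-distribˡ-sum a (λ i → lookup f i * φ (toℕ i) x)))

  eval-+ᴹ : ∀ f g x → eval (f +ᴹ g) x ≡ eval f x + eval g x
  eval-+ᴹ f g x = trans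
    (sum-cong-≗ {n} λ i →
        trans (cong (_* φ (toℕ i) x) (lookup-zipWith _+_ i f g)) (distribʳ _ (lookup f i) (lookup g i)))
    (∑-distrib-+ {n} (λ i → lookup f i * φ (toℕ i) x) (λ i → lookup g i * φ (toℕ i) x))

  eval-*ₗ : ∀ a f x → eval (a *ₗ f) x ≡ a * eval f x
  eval-*ₗ a f x = trans
    (sum-cong-≗ {n} λ i →
        trans (cong (_* φ (toℕ i) x) (lookup-map i (a *_) f)) (*-assoc a (lookup f i) _))
    (sym (*-distribˡ-sum a (λ i → lookup f i * φ (toℕ i) x)))

  eval-0ᴹ : ∀ x → eval 0ᴹ x ≡ 0#
  eval-0ᴹ x = trans
    (sum-cong-≗ {n} λ i → trans (cong (_* φ (toℕ i) x) (lookup-replicate i 0#)) (zeroˡ _))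
    (sum-replicate-zero n)

  eval-negᴹ : ∀ f x → eval (-ᴹ f) x ≡ - eval f x
  eval-negᴹ f x = trans
    (sum-cong-≗ {n} λ i → cong (_* φ (toℕ i) x) (trans (lookup-map i -_ f)
      (trans (sym (-1*x≈-x _)) (sym (lookup-map i (- 1# *_) f)))))
    (trans (eval-*ₗ (- 1#) f x) (-1*x≈-x _))

  eval-sumᴹ : ∀ {m} (v : Vector Lin m) x → eval (sumᴹ v) x ≡ sum (λ i → eval (v i) x)
  eval-sumᴹ {zero}  v x = eval-0ᴹ x
  eval-sumᴹ {suc m} v x =
      trans (eval-+ᴹ (v zero) _ x) (cong (eval (v zero) x +_) (eval-sumᴹ (v ∘ suc) x))

  eval-combination : ∀ {m} c (v : Vector Lin m) x →
      eval (combination c v) x ≡ sum (λ i → c i * eval (v i) x)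
  eval-combination c v x =
      trans (eval-sumᴹ (λ i → c i *ₗ v i) x) (sum-cong-≗ λ i → eval-*ₗ (c i) (v i) x)

  eval-monomial : ∀ a j x → eval (monomial a j) x ≡ a * frob x j
  eval-monomial a j x =
      trans (sum-single +-commutativeMonoid (λ i → lookup (monomial a j) i * φ (toℕ i) x) k
      λ i i≢k → trans (cong (_* φ (toℕ i) x)
          (trans (lookup∘updateAt′ i k i≢k (replicate n 0#)) (lookup-replicate i 0#))) (zeroˡ _))
    (cong₂ _*_ (lookup∘updateAt k (replicate n 0#)) (cong (λ l → φ l x) (Fin.toℕ-fromℕ< (n%ℕd<d j n))))
    where k = fromℕ< (n%ℕd<d j n)

  eval-x^[] : ∀ j x → eval x^[ j ] x ≡ frob x j
  eval-x^[] j x = trans (eval-monomial 1# j x) (*-identityˡ _)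

  additive-sum : (τ : Carrier → Carrier) → (∀ x y → τ (x + y) ≡ τ x + τ y) →
                 ∀ {m} (t : Vector Carrier m) → τ (sum t) ≡ sum (τ ∘ t)
  additive-sum τ τ-+ {zero}  t = additive-0 τ τ-+
  additive-sum τ τ-+ {suc m} t = trans (τ-+ _ _) (cong (τ (t zero) +_) (additive-sum τ τ-+ (t ∘ suc)))

  -- A power of Frobenius is a ring homomorphism, so it passes through the sum; wrapping the index i
  -- + j modulo n is harmless since φ n is the identity on F.
  eval-^[] : ∀ f j x → eval (f ^[ j ]) x ≡ frob (eval f x) j
  eval-^[] f j x = begin
    eval (f ^[ j ]) x
      ≡⟨ eval-sumᴹ (λ i → monomial (frob (lookup f i) j) (ℤ.+ toℕ i ℤ.+ j)) x ⟩
    sum (λ i → eval (monomial (frob (lookup f i) j) (ℤ.+ toℕ i ℤ.+ j)) x)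
      ≡⟨ sum-cong-≗ {n} (λ i → trans (eval-monomial _ (ℤ.+ toℕ i ℤ.+ j) x) (trans
           (cong (frob (lookup f i) j *_)
               (trans (frob-frob (ℤ.+ toℕ i) j x) (cong (λ y → frob y j) (frob-+ (toℕ i) x))))
           (sym (φ-* (j %ℕ n) _ _)))) ⟩
    sum (λ i → frob (lookup f i * φ (toℕ i) x) j)
      ≡⟨ additive-sum (φ (j %ℕ n)) (φ-+ (j %ℕ n)) (λ i → lookup f i * φ (toℕ i) x) ⟨
    frob (eval f x) j ∎
    where open ≡-Reasoning

  eval-∘ᴸ : ∀ f g x → eval (f ∘ᴸ g) x ≡ eval f (eval g x)
  eval-∘ᴸ f g x = trans (eval-combination (lookup f) (λ i → g ^[ ℤ.+ toℕ i ]) x)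
    (sum-cong-≗ {n} λ i →
        cong (lookup f i *_) (trans (eval-^[] g (ℤ.+ toℕ i) x) (frob-+ (toℕ i) (eval g x))))

  -- If the difference were nonzero, its qⁿ roots would violate the root bound, which reads q · qⁿ ≤
  -- qⁿ here.
  eval-injective : ∀ {f g} → (∀ x → eval f x ≡ eval g x) → f ≡ g
  eval-injective {f} {g} eq = begin
    f                     ≡⟨ tabulate∘lookup f ⟨
    tabulate (lookup f)   ≡⟨ tabulate-cong coefficients ⟩
    tabulate (lookup g)   ≡⟨ tabulate∘lookup g ⟩
    g                     ∎
    where
    open ≡-Reasoning
    open SkewRoots 1
    h = f +ᴹ -ᴹ g
    isRoot : ∀ x → Skew.apply 1 h x ≡ 0#
    isRoot x = trans (sym (eval≡apply h x)) (trans (eval-+ᴹ f (-ᴹ g) x)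
      (trans (cong₂ _+_ (eq x) (eval-negᴹ g x)) (-‿inverseʳ _)))
    h≡0 : h ≡ 0ᴹ
    h≡0 = decidable-stable (≡-dec _≟_ h 0ᴹ) λ h≢0 → ℕ.<⇒≱ (ℕ.^-monoʳ-< q 1<q (ℕ.n<1+n n))
      (subst₂ (λ c m → c ℕ.* m ≤ c ℕ.^ n) (#fixed 1 λ {x} → trans (sym (φ1≡^q x)))
          (#-all (root? h) isRoot)
        (#roots-bound h h≢0))
    coefficients : ∀ i → lookup f i ≡ lookup g i
    coefficients i = x-y≡0⇒x≡y (begin
      lookup f i + - lookup g i      ≡⟨ cong (lookup f i +_) (lookup-map i -_ g) ⟨
      lookup f i + lookup (-ᴹ g) i   ≡⟨ lookup-zipWith _+_ i f (-ᴹ g) ⟨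
      lookup h i                     ≡⟨ cong (λ h → lookup h i) h≡0 ⟩
      lookup 0ᴹ i                    ≡⟨ lookup-replicate i 0# ⟩
      0#                             ∎)

  image-subspace : ∀ f → OverF.IsSubspace 𝔽q (Image f)
  image-subspace f = (0# , additive-0 (eval f) (eval-+ f))
    , (λ (x , fx) (y , fy) → x + y , trans (eval-+ f x y) (cong₂ _+_ fx fy))
    , (λ {a} aK (x , fx) → a * x , trans (eval-* f aK x) (cong (a *_) fx))

  kernelᴸ? : ∀ f → Decidable λ x → eval f x ≡ 0#
  kernelᴸ? f = kernel? (eval f) (eval-+ f)

  rank : ∀ f → ∃ (HasRank f)
  rank f = basis (image? (eval f) (eval-+ f)) (image-subspace f)

  rank-nullity : ∀ f {r} → HasRank f r → q ℕ.^ r ℕ.* # (kernelᴸ? f) ≡ q ℕ.^ n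
  rank-nullity f dim = trans
    (cong (ℕ._* # (kernelᴸ? f)) (sym (dimension⇒# (image? (eval f) (eval-+ f)) dim)))
    (#image*#kernel (eval f) (eval-+ f))

-- Size and minimum distance of codes; kernels of the words of ℋ.

module Codes (q n : ℕ) .{{_ : NonZero n}} (primePower : IsPrimePower q) (F : FiniteField (q ℕ.^ n)) where
  open RankNullity q n primePower F public

  1<order : 1 < q ℕ.^ n
  1<order = ℕ.^-monoʳ-< q 1<q (ℕ.>-nonZero⁻¹ n)

  span-+ : ∀ {m} {b : Vector Lin m} {f g} → f ∈ Span U b → g ∈ Span U b → f +ᴹ g ∈ Span U b
  span-+ {b = b} (c , _ , refl) (d , _ , refl) = (λ i → c i + d i) , _ , eval-injective λ x → begin
    eval (combination (λ i → c i + d i) b) x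
      ≡⟨ eval-combination (λ i → c i + d i) b x ⟩
    sum (λ i → (c i + d i) * eval (b i) x)
      ≡⟨ sum-cong-≗ (λ i → distribʳ (eval (b i) x) (c i) (d i)) ⟩
    sum (λ i → c i * eval (b i) x + d i * eval (b i) x)
      ≡⟨ ∑-distrib-+ (λ i → c i * eval (b i) x) (λ i → d i * eval (b i) x) ⟩
    sum (λ i → c i * eval (b i) x) + sum (λ i → d i * eval (b i) x)
      ≡⟨ cong₂ _+_ (eval-combination c b x) (eval-combination d b x) ⟨
    eval (combination c b) x + eval (combination d b) x
      ≡⟨ eval-+ᴹ (combination c b) (combination d b) x ⟨
    eval (combination c b +ᴹ combination d b) x ∎
    where open ≡-Reasoning

  span-* : ∀ {m} {b : Vector Lin m} {f} a → f ∈ Span U b → a *ₗ f ∈ Span U b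
  span-* {b = b} a (c , _ , refl) = (λ i → a * c i) , _ , eval-injective λ x → begin
    eval (combination (λ i → a * c i) b) x  ≡⟨ eval-combination (λ i → a * c i) b x ⟩
    sum (λ i → a * c i * eval (b i) x)      ≡⟨ sum-cong-≗ (λ i → *-assoc a (c i) (eval (b i) x)) ⟩
    sum (λ i → a * (c i * eval (b i) x))    ≡⟨ *-distribˡ-sum a (λ i → c i * eval (b i) x) ⟨
    a * sum (λ i → c i * eval (b i) x)      ≡⟨ cong (a *_) (eval-combination c b x) ⟨
    a * eval (combination c b) x            ≡⟨ eval-*ₗ a (combination c b) x ⟨
    eval (a *ₗ combination c b) x           ∎
    where open ≡-Reasoning

  combination-zero : ∀ {m} (c : Vector Carrier m) (b : Vector Lin m) → (∀ i → c i ≡ 0#) →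
      combination c b ≡ 0ᴹ
  combination-zero {m} c b c≡0 = eval-injective λ x → begin
    eval (combination c b) x         ≡⟨ eval-combination c b x ⟩
    sum (λ i → c i * eval (b i) x)
      ≡⟨ sum-cong-≗ (λ i → trans (cong (_* eval (b i) x) (c≡0 i)) (zeroˡ _)) ⟩
    sum {m} (λ i → 0#)               ≡⟨ sum-replicate-zero m ⟩
    0#                               ≡⟨ eval-0ᴹ x ⟨
    eval 0ᴹ x                        ∎
    where open ≡-Reasoning

  -ᴹ≡ : ∀ f → -ᴹ f ≡ - 1# *ₗ f
  -ᴹ≡ f = eval-injective λ x → trans (eval-negᴹ f x) (sym (trans (eval-*ₗ (- 1#) f x) (-1*x≈-x _)))

  eval-- : ∀ f g x → eval (f +ᴹ -ᴹ g) x ≡ eval f x + - eval g x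
  eval-- f g x = trans (eval-+ᴹ f (-ᴹ g) x) (cong (eval f x +_) (eval-negᴹ g x))

  f-g≡0⇒f≡g : ∀ {f g} → f +ᴹ -ᴹ g ≡ 0ᴹ → f ≡ g
  f-g≡0⇒f≡g {f} {g} eq = eval-injective λ x → x-y≡0⇒x≡y
    (trans (sym (eval-- f g x)) (trans (cong (λ h → eval h x) eq) (eval-0ᴹ x)))

  module LinSpan = SpanEnumeration F linSpace
  module USpan {r} (b : Vector Lin r) = LinSpan.Elements {U} (Inverse.from enumeration)
    from-injective _ (λ {a} _ → Inverse.to enumeration a , Inverse.strictlyInverseʳ enumeration a) b

  U-element-injective : ∀ {r} (b : Vector Lin r) → LinearlyIndependent U b →
                        ∀ {i j} → USpan.element b i ≡ USpan.element b j → i ≡ j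
  U-element-injective b independent {i} {j} =
      USpan.element-injective b _ x-y≡0⇒x≡y difference independent {i} {j}
    where
    open ≡-Reasoning
    difference : ∀ c d → combination c b ≡ combination d b → combination (λ i → c i + - d i) b ≡ 0ᴹ
    difference c d eq = eval-injective λ x → begin
      eval (combination (λ i → c i + - d i) b) x     ≡⟨ eval-combination (λ i → c i + - d i) b x ⟩
      sum (λ i → (c i + - d i) * eval (b i) x)       ≡⟨ combination-difference c d (λ i → eval (b i) x) ⟩
      sum (λ i → c i * eval (b i) x) + - sum (λ i → d i * eval (b i) x)
        ≡⟨ cong₂ (λ u v → u + - v) (eval-combination c b x) (eval-combination d b x) ⟨
      eval (combination c b) x + - eval (combination d b) x
        ≡⟨ cong (λ f → eval (combination c b) x + - eval f x) eq ⟨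
      eval (combination c b) x + - eval (combination c b) x ≡⟨ -‿inverseʳ _ ⟩
      0#                                             ≡⟨ eval-0ᴹ x ⟨
      eval 0ᴹ x                                      ∎

  -- The (qⁿ)^k combinations of a basis are distinct, while `Lin` has only (qⁿ)^n elements.
  dimension≤n : ∀ {C k} → HasDimension U C k → k ≤ n
  dimension≤n {k = k} (b , independent , _) = ℕ.≮⇒≥ λ n<k → ℕ.<⇒≱ (ℕ.^-monoʳ-< (q ℕ.^ n) 1<order n<k)
    (Fin.injective⇒≤ {f = code ∘ element}
        (λ {i} {j} eq → U-element-injective b independent {i} {j} (code-injective eq)))
    where
    open USpan b
    code : Lin → Fin ((q ℕ.^ n) ℕ.^ n)
    code f = funToFin (Inverse.to enumeration ∘ lookup f)
    code-injective : ∀ {f g} → code f ≡ code g → f ≡ g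
    code-injective {f} {g} eq = begin
      f                     ≡⟨ tabulate∘lookup f ⟨
      tabulate (lookup f)   ≡⟨ tabulate-cong (λ i → to-injective (begin
        Inverse.to enumeration (lookup f i)
          ≡⟨ Fin.finToFun-funToFin (Inverse.to enumeration ∘ lookup f) i ⟨
        finToFun (code f) i                   ≡⟨ cong (λ c → finToFun c i) eq ⟩
        finToFun (code g) i
          ≡⟨ Fin.finToFun-funToFin (Inverse.to enumeration ∘ lookup g) i ⟩
        Inverse.to enumeration (lookup g i)   ∎)) ⟩
      tabulate (lookup g)   ≡⟨ tabulate∘lookup g ⟩
      g                     ∎
      where open ≡-Reasoning

  dimension⇒size : ∀ {C k} → HasDimension U C k → HasSize C (q ℕ.^ (n ℕ.* k))
  dimension⇒size {C} {k} (b , independent , C⊆ , ⊆C) = subst (HasSize C) (ℕ.^-*-assoc q n k)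
    ( element
    , (λ {i} {j} → U-element-injective b independent {i} {j})
    , (λ f∈C → element-complete (C⊆ f∈C))
    , λ (i , eq) → ⊆C (element∈Span {i} eq))
    where open USpan b

  -- Relations among the remaining vectors are padded with zero coefficients. Applied to a basis of
  -- F, this leaves the k points at which codewords are compared.
  independent-drop : ∀ d {m} (b : Vector Carrier (d ℕ.+ m)) → OverF.LinearlyIndependent 𝔽q b →
                     ∃ λ (b : Vector Carrier m) → OverF.LinearlyIndependent 𝔽q b
  independent-drop zero    b independent = b , independent
  independent-drop (suc d) b independent = independent-drop d (b ∘ suc) λ c c∈K eq i →
    independent (0# Vector.∷ c) (λ where zero → trans (sym (φ1≡^q 0#)) (φ-0 1) ; (suc i) → c∈K i)
      (trans (cong₂ _+_ (zeroˡ (b zero)) eq) (+-identityˡ 0#)) (suc i)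

  -- The minimum distance n - k is attained: by the pigeonhole principle some two
  -- words agree on k independent points, so their difference has rank at most n - k.
  isMRD : ∀ {C k} → HasDimension U C (suc k) →
          (∀ {f} → f ∈ C → f ≢ 0ᴹ → q ℕ.* # (kernelᴸ? f) ≤ q ℕ.^ suc k) → IsMRD C
  isMRD {C} {k} dim@(b , independent , C⊆ , ⊆C) kernel-bound =
      ( ⊆C ((λ _ → 0#) , _ , combination-zero (λ _ → 0#) b (λ _ → refl))
      , C-+ , (λ {a} _ f∈C → ⊆C (span-* {b = b} a (C⊆ f∈C))))
    , n ∸ k
    , (attained , minimal)
    -- Here d = n - k, so n - d + 1 is the dimension k + 1; the truncated subtraction is exact
    -- because k < n.
    , subst (λ m → HasSize C (q ℕ.^ (n ℕ.* m)))
        (sym (trans (cong (ℕ._+ 1) (ℕ.m∸[m∸n]≡n (ℕ.<⇒≤ k<n))) (ℕ.+-comm k 1))) (dimension⇒size dim)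
    where
    open USpan b
    k<n : k < n
    k<n = dimension≤n dim
    C-+ : ∀ {f g} → f ∈ C → g ∈ C → f +ᴹ g ∈ C
    C-+ f∈C g∈C = ⊆C (span-+ {b = b} (C⊆ f∈C) (C⊆ g∈C))
    minimal : ∀ {f g r} → f ∈ C → g ∈ C → f ≢ g → HasRank (f +ᴹ -ᴹ g) r → n ∸ k ≤ r
    minimal {f} {g} {r} f∈C g∈C f≢g hasRank =
        -- Were r + k < n, rank-nullity multiplied by q together with the kernel bound would give
        -- q^(n+1) ≤ q^(r+k+1).
        ℕ.m≤n+o⇒m∸n≤o n k (subst (n ≤_) (ℕ.+-comm r k) (ℕ.≮⇒≥ λ r+k<n →
      ℕ.<⇒≱ (ℕ.^-monoʳ-< q 1<q (s≤s r+k<n)) (begin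
        q ℕ.* q ℕ.^ n                         ≡⟨ cong (q ℕ.*_) (rank-nullity h hasRank) ⟨
        q ℕ.* (q ℕ.^ r ℕ.* # (kernelᴸ? h))
          ≡⟨ trans (sym (ℕ.*-assoc q (q ℕ.^ r) _))
               (trans (cong (ℕ._* # (kernelᴸ? h)) (ℕ.*-comm q (q ℕ.^ r))) (ℕ.*-assoc (q ℕ.^ r) q _)) ⟩
        q ℕ.^ r ℕ.* (q ℕ.* # (kernelᴸ? h))    ≤⟨ ℕ.*-monoʳ-≤ (q ℕ.^ r) (kernel-bound {h}
                                                   (C-+ {f} { -ᴹ g} f∈C (subst C (sym (-ᴹ≡ g))
                                                       (⊆C (span-* {b = b} (- 1#) (C⊆ g∈C)))))
                                                   (f≢g ∘ f-g≡0⇒f≡g {f} {g})) ⟩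
        q ℕ.^ r ℕ.* q ℕ.^ suc k               ≡⟨ ℕ.^-distribˡ-+-* q r (suc k) ⟨
        q ℕ.^ (r ℕ.+ suc k)                   ≡⟨ cong (q ℕ.^_) (ℕ.+-suc r k) ⟩
        q ℕ.^ suc (r ℕ.+ k)                   ∎)))
      where
      open ℕ.≤-Reasoning
      h = f +ᴹ -ᴹ g
    points : ∃ λ (u : Vector Carrier k) → OverF.LinearlyIndependent 𝔽q u
    points = independent-drop (n ∸ k)
      (proj₁ basis′) (proj₂ basis′)
      where
      basis′ = subst (λ m → ∃ λ (b : Vector Carrier m) → OverF.LinearlyIndependent 𝔽q b)
          (sym (ℕ.m∸n+n≡m (ℕ.<⇒≤ k<n))) 𝔽q-basis
    attained : ∃ λ f → ∃ λ g → f ∈ C × g ∈ C × f ≢ g × HasRank (f +ᴹ -ᴹ g) (n ∸ k)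
    attained = from-collision
      -- There are (qⁿ)^(k+1) coefficient vectors but only (qⁿ)^k tuples of values at k points.
      (Fin.pigeonhole (ℕ.^-monoʳ-< (q ℕ.^ n) 1<order (ℕ.n<1+n k)) (λ i → funToFin (values i)))
      where
      u = proj₁ points
      values : Fin ((q ℕ.^ n) ℕ.^ suc k) → Fin k → Fin (q ℕ.^ n)
      values i t = Inverse.to enumeration (eval (element i) (u t))
      from-collision : (∃ λ i → ∃ λ j → i Fin.< j × funToFin (values i) ≡ funToFin (values j)) →
                       ∃ λ f → ∃ λ g → f ∈ C × g ∈ C × f ≢ g × HasRank (f +ᴹ -ᴹ g) (n ∸ k)
      from-collision (i , j , i<j , eq) =
          f , g , f∈C , g∈C , f≢g , subst (HasRank h) rank≡ (proj₂ (rank h))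
        where
        f = element i
        g = element j
        h = f +ᴹ -ᴹ g
        f∈C = ⊆C (element∈Span {i} refl)
        g∈C = ⊆C (element∈Span {j} refl)
        f≢g : f ≢ g
        f≢g f≡g = Fin.<⇒≢ i<j (U-element-injective b independent {i} {j} f≡g)
        agree : ∀ t → eval f (u t) ≡ eval g (u t)
        agree t = to-injective (begin
          values i t                        ≡⟨ Fin.finToFun-funToFin (values i) t ⟨
          finToFun (funToFin (values i)) t  ≡⟨ cong (λ c → finToFun c t) eq ⟩
          finToFun (funToFin (values j)) t  ≡⟨ Fin.finToFun-funToFin (values j) t ⟩
          values j t                        ∎)
          where open ≡-Reasoning
        h-vanishes : ∀ {x} → x ∈ OverF.Span 𝔽q u → eval h x ≡ 0#
        h-vanishes (c , c∈K , refl) = begin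
          eval h (sum (λ t → c t * u t))      ≡⟨ additive-sum (eval h) (eval-+ h) (λ t → c t * u t) ⟩
          sum (λ t → eval h (c t * u t))      ≡⟨ sum-cong-≗
              (λ t → trans (eval-* h (c∈K t) (u t)) (trans (cong (c t *_)
                                                   (trans (eval-- f g (u t))
                                                       (trans (cong (_+ - eval g (u t)) (agree t))
                                                           (-‿inverseʳ _)))) (zeroʳ _))) ⟩
          sum {k} (λ t → 0#)                  ≡⟨ sum-replicate-zero k ⟩
          0#                                  ∎
          where open ≡-Reasoning
        qᵏ≤#kernel : q ℕ.^ k ≤ # (kernelᴸ? h)
        qᵏ≤#kernel = injection⇒≤# (kernelᴸ? h) (𝔽qSpan.element u)
          (λ {i} {j} → 𝔽q-element-injective u (proj₂ points) {i} {j})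
          (λ i → h-vanishes (𝔽qSpan.element∈Span u {i} refl))
        r = proj₁ (rank h)
        r+k≤n : r ℕ.+ k ≤ n
        r+k≤n = ℕ.≮⇒≥ λ n<r+k → ℕ.<⇒≱ (ℕ.^-monoʳ-< q 1<q n<r+k) (begin
          q ℕ.^ (r ℕ.+ k)                 ≡⟨ ℕ.^-distribˡ-+-* q r k ⟩
          q ℕ.^ r ℕ.* q ℕ.^ k             ≤⟨ ℕ.*-monoʳ-≤ (q ℕ.^ r) qᵏ≤#kernel ⟩
          q ℕ.^ r ℕ.* # (kernelᴸ? h)      ≡⟨ rank-nullity h (proj₂ (rank h)) ⟩
          q ℕ.^ n                         ∎)
          where open ℕ.≤-Reasoning
        rank≡ : r ≡ n ∸ k
        rank≡ = ℕ.≤-antisym (ℕ.m+n≤o⇒m≤o∸n r r+k≤n) (minimal {f} {g} f∈C g∈C f≢g (proj₂ (rank h)))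

  -- The dimension of the code, k in the paper, is suc k from here on.
  module Twisted (k : ℕ) (s : ℤ) (s-coprime : ℤ.gcd s (ℤ.+ n) ≡ ℤ.+ 1) (η : Carrier)
                 (norm-η : norm η ≢ (- 1#) ^ (suc k ℕ.* n)) where

    ρ : ℕ
    ρ = s %ℕ n

    open Skew ρ
    open SkewRoots ρ
    open Norm norm norm-* norm-1 (norm-φ ρ)

    gens : Vector Lin (suc k)
    gens = generators (suc k) s η

    -- Coprimality of s and n enters here: it keeps the fixed field of x^{[s]} from being larger
    -- than 𝔽q.
    #fixed≡q : # fixed? ≡ q
    #fixed≡q = #fixed ρ (frob-fixed⇒∈𝔽q s s-coprime)

    apply-tabulate : ∀ {m} (c : Vector Carrier m) x →
        apply (tabulate c) x ≡ sum (λ i → c i * φ (toℕ i ℕ.* ρ) x)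
    apply-tabulate {zero}  c x = refl
    apply-tabulate {suc m} c x = cong₂ _+_ (cong (c zero *_) (sym (φ-0th x)))
      (trans (apply-tabulate (c ∘ suc) (φ ρ x)) (sum-cong-≗ {m} λ i → cong (c (suc i) *_)
        (trans (φ-φ (toℕ i ℕ.* ρ) ρ x) (cong (λ l → φ l x) (ℕ.+-comm (toℕ i ℕ.* ρ) ρ)))))

    apply-∷ʳ : ∀ {m} (f : Poly m) a x → apply (f ∷ʳ a) x ≡ apply f x + a * φ (m ℕ.* ρ) x
    apply-∷ʳ []      a x = trans (+-comm _ _) (cong (λ y → 0# + a * y) (sym (φ-0th x)))
    apply-∷ʳ {suc m} (b ∷ f) a x = trans (cong (b * x +_) (trans (apply-∷ʳ f a (φ ρ x))
      (cong (λ y → apply f (φ ρ x) + a * y)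
          (trans (φ-φ (m ℕ.* ρ) ρ x) (cong (λ l → φ l x) (ℕ.+-comm (m ℕ.* ρ) ρ))))))
      (sym (+-assoc _ _ _))

    -- The twist in the first generator contributes the extra coefficient c₀η in degree k + 1, so
    -- constant and leading coefficients are tied and their norms differ by the factor N(η).
    poly : Vector Carrier (suc k) → Poly (suc (suc k))
    poly c = tabulate c ∷ʳ (c zero * η)

    eval-gens-zero : ∀ x → eval (gens zero) x ≡ x + η * frob x (s ℤ.* ℤ.+ suc k)
    eval-gens-zero x = trans (eval-+ᴹ x^[ ℤ.+ 0 ] _ x) (cong₂ _+_
      (trans (eval-x^[] (ℤ.+ 0) x) (trans (frob-+ 0 x) (φ-0th x)))
      (trans (eval-*ₗ η x^[ s ℤ.* ℤ.+ suc k ] x) (cong (η *_) (eval-x^[] (s ℤ.* ℤ.+ suc k) x))))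

    eval-twisted : ∀ c x → eval (combination c gens) x ≡ apply (poly c) x
    eval-twisted c x = begin
      eval (combination c gens) x
        ≡⟨ eval-combination c gens x ⟩
      c zero * eval (gens zero) x + sum (λ i → c (suc i) * eval (gens (suc i)) x)
        ≡⟨ cong₂ _+_
             (cong (c zero *_) (trans (eval-gens-zero x)
                 (cong₂ (λ y z → y + η * z) (sym (φ-0th x)) (frob-* s (suc k) x))))
             (sum-cong-≗ {k} λ i →
                 cong (c (suc i) *_) (trans (eval-x^[] (s ℤ.* ℤ.+ suc (toℕ i)) x)
                     (frob-* s (suc (toℕ i)) x))) ⟩
      c zero * (φ 0 x + η * φ (suc k ℕ.* ρ) x) + sum (λ i → c (suc i) * φ (suc (toℕ i) ℕ.* ρ) x)
        ≡⟨ solve 5 (λ c y η z t → c :* (y :+ η :* z) :+ t := (c :* y :+ t) :+ (c :* η) :* z) refl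
             (c zero) (φ 0 x) η (φ (suc k ℕ.* ρ) x) (sum (λ i → c (suc i) * φ (suc (toℕ i) ℕ.* ρ) x)) ⟩
      sum (λ i → c i * φ (toℕ i ℕ.* ρ) x) + c zero * η * φ (suc k ℕ.* ρ) x
        ≡⟨ cong (_+ c zero * η * φ (suc k ℕ.* ρ) x) (apply-tabulate c x) ⟨
      apply (tabulate c) x + c zero * η * φ (suc k ℕ.* ρ) x
        ≡⟨ apply-∷ʳ (tabulate c) (c zero * η) x ⟨
      apply (poly c) x ∎
      where open ≡-Reasoning

    signs-cancel : ∀ m → (- 1#) ^ m * (- 1#) ^ m ≡ 1#
    signs-cancel m = trans (sym (^-distrib-* (- 1#) (- 1#) m))
      (trans (cong (_^ m) (trans (-1*x≈-x (- 1#)) (⁻¹-involutive 1#))) (1^ m))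

    -- Cancelling N(a) in the equality would leave 1 = ε N(η) with the sign ε = (-1)^((k+1)n), which
    -- is its own inverse; this would give N(η) = ε.
    norms-differ : ∀ {a} → a ≢ 0# → norm a ≢ norm (- 1#) ^ suc k * norm (a * η)
    norms-differ {a} a≢0 eq = norm-η (begin
      norm η                            ≡⟨ *-identityˡ _ ⟨
      1# * norm η                       ≡⟨ cong (_* norm η) (signs-cancel (suc k ℕ.* n)) ⟨
      ε * ε * norm η                    ≡⟨ *-assoc ε ε (norm η) ⟩
      ε * (ε * norm η)                  ≡⟨ cong (ε *_) (*-cancelˡ (N-≢0 a≢0) (begin
        norm a * (ε * norm η)
          ≡⟨ solve 3 (λ x y z → x :* (y :* z) := y :* (x :* z)) refl (norm a) ε (norm η) ⟩
        ε * (norm a * norm η)             ≡⟨ cong₂ _*_ ε≡ (norm-* a η) ⟨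
        norm (- 1#) ^ suc k * norm (a * η) ≡⟨ eq ⟨
        norm a                            ≡⟨ *-identityʳ _ ⟨
        norm a * 1#                       ∎)) ⟩
      ε * 1#                            ≡⟨ *-identityʳ ε ⟩
      ε                                 ∎)
      where
      open ≡-Reasoning
      ε = (- 1#) ^ (suc k ℕ.* n)
      ε≡ : norm (- 1#) ^ suc k ≡ ε
      ε≡ = trans (cong (_^ suc k) norm-neg-1)
          (trans (^-assocʳ (- 1#) n (suc k)) (cong ((- 1#) ^_) (ℕ.*-comm n (suc k))))

    private
      q-bound : ∀ m t → # fixed? ℕ.* m ≤ # fixed? ℕ.^ t → q ℕ.* m ≤ q ℕ.^ t
      q-bound m t = subst (λ c → c ℕ.* m ≤ c ℕ.^ t) #fixed≡q

    kernel-bound : ∀ c → ¬ (∀ i → c i ≡ 0#) → q ℕ.* # (kernelᴸ? (combination c gens)) ≤ q ℕ.^ suc k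
    kernel-bound c c≢0 with c zero ≟ 0#
    ... | no c₀≢0 = subst (λ m → q ℕ.* m ≤ q ℕ.^ suc k)
          (#-cong (root? (poly c)) (kernelᴸ? (combination c gens)) (trans (eval-twisted c _))
              (trans (sym (eval-twisted c _))))
          (q-bound (# (root? (poly c))) (suc k)
              (#roots-norm-bound (poly c) λ eq → norms-differ c₀≢0 (trans eq
            (cong (λ a → norm (- 1#) ^ suc k * norm a) (last-∷ʳ (c zero * η) (tabulate c))))))
    -- Without c₀ the twist disappears as well: only k + 1 coefficients remain, and the plain root
    -- bound already gives q^(k+1).
    ... | yes c₀≡0 = subst (λ m → q ℕ.* m ≤ q ℕ.^ suc k)
          (#-cong (root? (tabulate c)) (kernelᴸ? (combination c gens)) (trans (untwisted _))
              (trans (sym (untwisted _))))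
          (q-bound (# (root? (tabulate c))) (suc k) (#roots-bound (tabulate c) λ eq → c≢0 λ i →
            trans (sym (lookup∘tabulate c i))
                (trans (cong (λ f → lookup f i) eq) (lookup-replicate i 0#))))
      where
      untwisted : ∀ x → eval (combination c gens) x ≡ apply (tabulate c) x
      untwisted x = trans (eval-twisted c x) (trans (apply-∷ʳ (tabulate c) (c zero * η) x)
        (trans (cong (apply (tabulate c) x +_)
            (trans (cong (_* φ (suc k ℕ.* ρ) x) (trans (cong (_* η) c₀≡0) (zeroˡ η))) (zeroˡ _)))
                (+-identityʳ _)))

-- The code as the composite of ℋ with p, and the conclusion.

module Characterisation (q n : ℕ) .{{_ : NonZero n}} (primePower : IsPrimePower q)
    (F : FiniteField (q ℕ.^ n)) where
  open Codes q n primePower F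

  module _ (k : ℕ) (s : ℤ) (s-coprime : ℤ.gcd s (ℤ.+ n) ≡ ℤ.+ 1) (η : Carrier)
           (norm-η : norm η ≢ (- 1#) ^ (suc k ℕ.* n))
           {C : Code} (dim : HasDimension U C (suc k)) {p r : Lin}
           (C≐ : IsDirectSum C (Span U (iterates p s k)) (Span U (λ (_ : Fin 1) → r)))
           (p-invertible : Invertible p)
           (w∈C : p +ᴹ η *ₗ p ^[ s ℤ.* ℤ.+ suc k ] ∈ C) where

    open Twisted k s s-coprime η norm-η

    p⁻¹ : Lin
    p⁻¹ = proj₁ p-invertible

    id-eval : ∀ x → eval x^[ ℤ.+ 0 ] x ≡ x
    id-eval x = trans (eval-x^[] (ℤ.+ 0) x) (trans (frob-+ 0 x) (φ-0th x))

    p-p⁻¹ : ∀ x → eval p (eval p⁻¹ x) ≡ x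
    p-p⁻¹ x = trans (sym (eval-∘ᴸ p p⁻¹ x))
        (trans (cong (λ f → eval f x) (proj₁ (proj₂ p-invertible))) (id-eval x))

    p⁻¹-p : ∀ x → eval p⁻¹ (eval p x) ≡ x
    p⁻¹-p x = trans (sym (eval-∘ᴸ p⁻¹ p x))
        (trans (cong (λ f → eval f x) (proj₂ (proj₂ p-invertible))) (id-eval x))

    evaluation : Carrier ↔ Carrier
    evaluation = mk↔ₛ′ (eval p) (eval p⁻¹) p-p⁻¹ p⁻¹-p

    w : Lin
    w = p +ᴹ η *ₗ p ^[ s ℤ.* ℤ.+ suc k ]

    iter : Vector Lin k
    iter = iterates p s k

    eval-w : ∀ x → eval w x ≡ eval (gens zero) (eval p x)
    eval-w x = trans (eval-+ᴹ p _ x) (trans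
      (cong (eval p x +_) (trans (eval-*ₗ η (p ^[ s ℤ.* ℤ.+ suc k ]) x)
          (cong (η *_) (eval-^[] p (s ℤ.* ℤ.+ suc k) x))))
      (sym (eval-gens-zero (eval p x))))

    eval-iter : ∀ i x → eval (iter i) x ≡ eval (gens (suc i)) (eval p x)
    eval-iter i x = trans (eval-^[] p (s ℤ.* ℤ.+ suc (toℕ i)) x)
        (sym (eval-x^[] (s ℤ.* ℤ.+ suc (toℕ i)) (eval p x)))

    -- Precomposition with p carries the generators of ℋ to `w` and the iterates, coefficient by
    -- coefficient; both inclusions between C and ℋ ∘ p rest on this.
    eval-w-iter : ∀ (c : Vector Carrier (suc k)) x →
      c zero * eval w x + eval (combination (c ∘ suc) iter) x ≡ eval (combination c gens) (eval p x)
    eval-w-iter c x = trans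
      (cong₂ _+_ (cong (c zero *_) (eval-w x)) (trans (eval-combination (c ∘ suc) iter x)
        (sum-cong-≗ {k} λ i → cong (c (suc i) *_) (eval-iter i x))))
      (sym (eval-combination c gens (eval p x)))

    C-+ : ∀ {f g} → f ∈ C → g ∈ C → f +ᴹ g ∈ C
    C-+ f∈C g∈C = let (b , _ , C⊆ , ⊆C) = dim in ⊆C (span-+ {b = b} (C⊆ f∈C) (C⊆ g∈C))

    C-* : ∀ a {f} → f ∈ C → a *ₗ f ∈ C
    C-* a f∈C = let (b , _ , C⊆ , ⊆C) = dim in ⊆C (span-* {b = b} a (C⊆ f∈C))

    iter∈C : ∀ c → combination c iter ∈ C
    iter∈C c = proj₂ (proj₁ C≐)
      ( combination c iter , 0ᴹ , (c , _ , refl)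
      , ((λ _ → 0#) , _ , combination-zero {1} (λ _ → 0#) (λ _ → r) (λ _ → refl))
      , eval-injective λ x → trans (eval-+ᴹ (combination c iter) 0ᴹ x)
          (trans (cong (eval (combination c iter) x +_) (eval-0ᴹ x)) (+-identityʳ _)))

    w-iter∈C : ∀ (c : Vector Carrier (suc k)) → c zero *ₗ w +ᴹ combination (c ∘ suc) iter ∈ C
    w-iter∈C c = C-+ {c zero *ₗ w} {combination (c ∘ suc) iter} (C-* (c zero) {w} w∈C) (iter∈C (c ∘ suc))

    eval-w-iterᴹ : ∀ (c : Vector Carrier (suc k)) x →
      eval (c zero *ₗ w +ᴹ combination (c ∘ suc) iter) x ≡ eval (combination c gens) (eval p x)
    eval-w-iterᴹ c x = trans (eval-+ᴹ (c zero *ₗ w) (combination (c ∘ suc) iter) x)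
      (trans (cong (_+ eval (combination (c ∘ suc) iter) x) (eval-*ₗ (c zero) w x)) (eval-w-iter c x))

    decomposition : ∀ {f} → f ∈ C → ∃ λ (c : Vector Carrier k) → ∃ λ b →
                    ∀ x → eval f x ≡ eval (combination c iter) x + b * eval r x
    decomposition f∈C with proj₁ (proj₁ C≐) f∈C
    ... | _ , _ , (c , _ , refl) , (b , _ , refl) , refl = c , b zero , λ x →
      trans (eval-+ᴹ (combination c iter) _ x) (cong (eval (combination c iter) x +_)
        (trans (eval-combination {1} b (λ _ → r) x) (+-identityʳ _)))

    α : Vector Carrier k
    α = proj₁ (decomposition w∈C)

    β : Carrier
    β = proj₁ (proj₂ (decomposition w∈C))

    eval-w≡ : ∀ x → eval w x ≡ eval (combination α iter) x + β * eval r x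
    eval-w≡ = proj₂ (proj₂ (decomposition w∈C))

    eval-iter-linear : ∀ (c d : Vector Carrier k) e x →
      eval (combination (λ i → c i + e * d i) iter) x ≡ eval (combination c iter) x + e * eval
          (combination d iter) x
    eval-iter-linear c d e x = begin
      eval (combination (λ i → c i + e * d i) iter) x
        ≡⟨ eval-combination (λ i → c i + e * d i) iter x ⟩
      sum (λ i → (c i + e * d i) * eval (iter i) x)
        ≡⟨ sum-cong-≗ {k} (λ i →
             solve 4 (λ c e d y → (c :+ e :* d) :* y := c :* y :+ e :* (d :* y)) refl (c i) e (d i)
                 (eval (iter i) x)) ⟩
      sum (λ i → c i * eval (iter i) x + e * (d i * eval (iter i) x))
        ≡⟨ ∑-distrib-+ {k} (λ i → c i * eval (iter i) x) (λ i → e * (d i * eval (iter i) x)) ⟩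
      sum (λ i → c i * eval (iter i) x) + sum (λ i → e * (d i * eval (iter i) x))
        ≡⟨ cong (sum (λ i → c i * eval (iter i) x) +_) (*-distribˡ-sum e (λ i → d i * eval (iter i) x)) ⟨
      sum (λ i → c i * eval (iter i) x) + e * sum (λ i → d i * eval (iter i) x)
        ≡⟨ cong₂ (λ u v → u + e * v) (eval-combination c iter x) (eval-combination d iter x) ⟨
      eval (combination c iter) x + e * eval (combination d iter) x ∎
      where open ≡-Reasoning

    -- Otherwise p + η p^{[s(k+1)]} lies in ⟨p^{[s]}, …, p^{[sk]}⟩, and a nonzero
    -- word of ℋ vanishes identically, contradicting k < n.
    β≢0 : β ≢ 0#
    β≢0 β≡0 = ℕ.<⇒≱ (ℕ.^-monoʳ-< q 1<q (s≤s (dimension≤n dim)))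
      (subst (λ m → q ℕ.* m ≤ q ℕ.^ suc k) (#-all (kernelᴸ? (combination c gens)) vanishes)
        (kernel-bound c λ c≡0 → 0≢1 (sym (c≡0 zero))))
      where
      open ≡-Reasoning
      c : Vector Carrier (suc k)
      -- These are the coefficients of w minus its expansion in the iterates. The form
      -- `0# + - 1# * α i` matches `eval-iter-linear`, and the leading 1 keeps the vector nonzero.
      c = 1# Vector.∷ λ i → 0# + - 1# * α i
      vanishes : ∀ y → eval (combination c gens) y ≡ 0#
      vanishes y = begin
        eval (combination c gens) y                  ≡⟨ cong (eval (combination c gens)) (p-p⁻¹ y) ⟨
        eval (combination c gens) (eval p x)         ≡⟨ eval-w-iter c x ⟨
        1# * eval w x + eval (combination (λ i → 0# + - 1# * α i) iter) x
          ≡⟨ cong₂ _+_ (trans (*-identityˡ _)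
               (trans (eval-w≡ x) (trans (cong (λ b → a + b * eval r x) β≡0)
               (trans (cong (a +_) (zeroˡ _)) (+-identityʳ a)))))
             (trans (eval-iter-linear (λ _ → 0#) α (- 1#) x) (cong₂ _+_
               (trans (cong (λ f → eval f x) (combination-zero (λ _ → 0#) iter (λ _ → refl)))
                   (eval-0ᴹ x)) (-1*x≈-x a))) ⟩
        a + (0# + - a)                               ≡⟨ cong (a +_) (+-identityˡ _) ⟩
        a + - a                                      ≡⟨ -‿inverseʳ a ⟩
        0#                                           ∎
        where
        x = eval p⁻¹ y
        a = eval (combination α iter) x

    -- As β is invertible, r can be eliminated in favour of `w`: a word with iterate coefficients a
    -- and r-coefficient b has coefficient e = b β⁻¹ on `w` and aᵢ - e αᵢ on the iterates.
    C⊆ℋ∘p : ∀ {f} → f ∈ C → ∃ λ c → ∀ x → eval f x ≡ eval (combination c gens) (eval p x)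
    C⊆ℋ∘p {f} f∈C = c , λ x → begin
      eval f x
        ≡⟨ proj₂ (proj₂ (decomposition f∈C)) x ⟩
      A x + b * eval r x
        ≡⟨ cong (λ z → A x + z * eval r x)
             (trans (*-assoc b _ β) (trans (cong (b *_) (*-inverseˡ β≢0)) (*-identityʳ b))) ⟨
      A x + e * β * eval r x
        -- The semiring solver cannot cancel, so (e - e) B is inserted by hand and `- e` is passed
        -- to it as an independent unknown m.
        ≡⟨ cong (_+ e * β * eval r x)
             (trans (cong (A x +_) (trans (cong (_* B x) (-‿inverseʳ e)) (zeroˡ _))) (+-identityʳ _)) ⟨
      (A x + (e + - e) * B x) + e * β * eval r x
        ≡⟨ solve 6 (λ A e m B β R →
             (A :+ (e :+ m) :* B) :+ e :* β :* R := e :* (B :+ β :* R) :+ (A :+ m :* B))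
             refl (A x) e (- e) (B x) β (eval r x) ⟩
      e * (B x + β * eval r x) + (A x + - e * B x)
        ≡⟨ cong₂ (λ u v → e * u + v) (eval-w≡ x) (eval-iter-linear a α (- e) x) ⟨
      e * eval w x + eval (combination (c ∘ suc) iter) x
        ≡⟨ eval-w-iter c x ⟩
      eval (combination c gens) (eval p x) ∎
      where
      open ≡-Reasoning
      a = proj₁ (decomposition f∈C)
      b = proj₁ (proj₂ (decomposition f∈C))
      e = b * β≢0 ⁻¹
      A = λ x → eval (combination a iter) x
      B = λ x → eval (combination α iter) x
      c : Vector Carrier (suc k)
      c = e Vector.∷ λ i → a i + - e * α i

    -- Since p permutes F, the kernel of f has as many elements as the kernel of the word of ℋ it
    -- comes from.
    codeword-bound : ∀ {f} → f ∈ C → f ≢ 0ᴹ → q ℕ.* # (kernelᴸ? f) ≤ q ℕ.^ suc k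
    codeword-bound {f} f∈C f≢0 = subst (λ m → q ℕ.* m ≤ q ℕ.^ suc k) #kernel≡
      (kernel-bound c λ c≡0 → f≢0 (eval-injective λ x → trans (f≡ x)
        (trans (cong (λ h → eval h (eval p x)) (combination-zero c gens c≡0))
            (trans (eval-0ᴹ _) (sym (eval-0ᴹ x))))))
      where
      c = proj₁ (C⊆ℋ∘p f∈C)
      f≡ = proj₂ (C⊆ℋ∘p f∈C)
      #kernel≡ : # (kernelᴸ? (combination c gens)) ≡ # (kernelᴸ? f)
      #kernel≡ = trans (∑-permute evaluation (λ x → indicator (kernelᴸ? (combination c gens) x)))
        (#-cong (kernelᴸ? (combination c gens) ∘ eval p) (kernelᴸ? f) (trans (f≡ _))
            (trans (sym (f≡ _))))

    mrd : IsMRD C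
    mrd = isMRD dim codeword-bound

    x-invertible : Invertible x^[ ℤ.+ 0 ]
    x-invertible = x^[ ℤ.+ 0 ] , identity , identity
      where
      identity : x^[ ℤ.+ 0 ] ∘ᴸ x^[ ℤ.+ 0 ] ≡ x^[ ℤ.+ 0 ]
      identity = eval-injective λ x → trans (eval-∘ᴸ x^[ ℤ.+ 0 ] x^[ ℤ.+ 0 ] x) (id-eval _)

    equivalent : Equivalent C (ℋ (suc k) s η)
    equivalent = x^[ ℤ.+ 0 ] , p⁻¹ , id , x-invertible ,
        (p , proj₂ (proj₂ p-invertible) , proj₁ (proj₂ p-invertible))
      , Identity.isRingIsomorphism rawRing refl
      , (λ { (f , f∈C , refl) → proj₁ (C⊆ℋ∘p f∈C) , _ , eval-injective λ x →
          sym (trans (eval-composite f x)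
               (trans (proj₂ (C⊆ℋ∘p f∈C) (eval p⁻¹ x))
                   (cong (eval (combination (proj₁ (C⊆ℋ∘p f∈C)) gens)) (p-p⁻¹ x)))) })
      , λ { (c , _ , refl) →
          -- The preimage of a word of ℋ keeps its coefficients and replaces each generator by its
          -- composite with p.
          c zero *ₗ w +ᴹ combination (c ∘ suc) iter , w-iter∈C c , eval-injective λ x →
              trans (eval-composite (c zero *ₗ w +ᴹ combination (c ∘ suc) iter) x)
                (trans (eval-w-iterᴹ c (eval p⁻¹ x)) (cong (eval (combination c gens)) (p-p⁻¹ x))) }
      where
      eval-composite : ∀ f x → eval (x^[ ℤ.+ 0 ] ∘ᴸ map id f ∘ᴸ p⁻¹) x ≡ eval f (eval p⁻¹ x)
      eval-composite f x = trans (eval-∘ᴸ x^[ ℤ.+ 0 ] (map id f ∘ᴸ p⁻¹) x) (trans (id-eval _)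
        (trans (eval-∘ᴸ (map id f) p⁻¹ x) (cong (λ g → eval g (eval p⁻¹ x)) (map-id f))))

open import Data.Integer.Base using (+_) renaming (_*_ to _*ℤ_)
open import Data.Integer.GCD using (gcd)
open import Data.Nat.Base using () renaming (_*_ to _*ℕ_; _^_ to _^ℕ_)

theorem3p10 : ∀ (q n : ℕ) .{{_ : NonZero n}} → IsPrimePower q →
    ∀ (F : FiniteField (q ^ℕ n)) →
    let open FiniteField F
        open LinearizedPolynomials q n F
    in
    ∀ (C : Code) (k : ℕ) → 2 < k → HasDimension U C k →
    C ∩ U₁ ≐ ｛ 0ᴹ ｝ →
    ∀ (s : ℤ) → gcd s (+ n) ≡ + 1 →
    HasDimension U (C ∩ C ^⟨ s ⟩) (k ∸ 2) →
    HasDimension U (C ∩ C ^⟨ s ⟩ ∩ C ^⟨ s *ℤ + 2 ⟩) (k ∸ 3) →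
    ∀ (p r : Lin) → r ∈ C →
    IsDirectSum C (Span U (iterates p s (k ∸ 1))) (Span U (λ (_ : Fin 1) → r)) →
    Invertible p →
    ∀ (η : Carrier) → η ≢ 0# →
    p +ᴹ η *ₗ p ^[ s *ℤ + k ] ∈ C →
    norm η ≢ (- 1#) ^ (k *ℕ n) →
    IsMRD C × Equivalent C (ℋ k s η)
theorem3p10 q n primePower F C (suc k) _ dim _ s s-coprime _ _ p r _ C≐ p-invertible η _ w∈C norm-η =
    mrd k s s-coprime η norm-η dim C≐ p-invertible w∈C
  , equivalent k s s-coprime η norm-η dim C≐ p-invertible w∈C
  where open Characterisation q n primePower F
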